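{- Let $k\ge1$. Every affine permutation $x\in\tilde S_{k+1}$ has a unique maximal decomposition into cyclically decreasing elements: among all sequences $(A_1,\dots,A_n)$ of nonempty proper subsets of $I$ with $x=d_{A_n}d_{A_{n-1}}\cdots d_{A_1}$ in the affine nil-Coxeter monoid, there is exactly one whose shape $(|A_1|,|A_2|,\dots,|A_n|)$ is lexicographically maximal.
   Context: Fix $k\ge1$ and let $I=\mathbb Z/(k+1)\mathbb Z$ (indices are taken mod $k+1$). $\tilde S_{k+1}$ is the group of bijections $x:\mathbb Z\to\mathbb Z$ with $x(i+k+1)=x(i)+k+1$ and $\sum_{i=1}^{k+1}x(i)=\binom{k+2}{2}$, generated by $s_i$ ($i\in I$), where $s_i$ exchanges $m(k+1)+i$ and $m(k+1)+i+1$ for all $m\in\mathbb Z$. The affine nil-Coxeter monoid $\hat{\mathbb A}_k$ is generated by $a_i$ ($i\in I$) and an absorbing zero $0$, with relations $a_i^2=0$, $a_ia_j=a_ja_i$ for $j\notin\{i-1,i,i+1\}$, and (for $k\ge2$) $a_ia_{i+1}a_i=a_{i+1}a_ia_{i+1}$. Nonzero elements of $\hat{\mathbb A}_k$ are identified with affine permutations by sending $a_{w_1}\cdots a_{w_l}$ to $s_{w_1}\cdots s_{w_l}$ for reduced words; a product $xy$ in $\hat{\mathbb A}_k$ is nonzero iff lengths add. For $A\subsetneq I$, the cyclically decreasing element $d_A$ is the product of the $a_i$, $i\in A$, each occurring once, ordered so that whenever $j,j-1\in A$ the letter $a_j$ is to the left of $a_{j-1}$ (this is well defined). -}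

module Defs where

open import Algebra.Properties.Monoid.Sum using (sum-syntax)
open import Data.Bool using (if_then_else_)
open import Data.Fin using (Fin; zero; toℕ; fromℕ<; _≟_)
open import Data.Fin.Properties using (any?; toℕ<n; toℕ-fromℕ<; toℕ-injective)
open import Data.Fin.Subset using (Subset; Nonempty; ⊤; ∣_∣; _∈_; _∉_; _⊂_)
open import Data.Fin.Subset.Properties using (_∈?_)
open import Data.Integer as ℤ using (ℤ; +_; 1ℤ)
open import Data.Integer.DivMod using (_%ℕ_; n%ℕd<d)
open import Data.Integer.Properties as ℤ using (+-0-monoid)
open import Data.List using (List; []; _∷_; length; map; foldr; filter; applyDownFrom)
import Data.List.Membership.Propositional as List
open import Data.List.Membership.Propositional.Properties
  using (∈-applyDownFrom⁺; ∈-filter⁺; ∈-filter⁻)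
open import Data.List.Properties using (filter-all)
open import Data.List.Relation.Binary.Lex.NonStrict using (Lex-≤)
import Data.List.Relation.Binary.Sublist.Propositional as Sublist
open import Data.List.Relation.Binary.Sublist.Propositional using (_∷_; _∷ʳ_)
import Data.List.Relation.Binary.Sublist.Propositional.Properties as Sublist
open import Data.List.Relation.Unary.All using (All; []; _∷_)
open import Data.List.Relation.Unary.Unique.Propositional using (Unique)
open import Data.List.Relation.Unary.Unique.Propositional.Properties
  using (filter⁺; applyDownFrom⁺₁)
open import Data.Nat using (ℕ; suc; _+_; _∸_; _≤_; _<_; s≤s)
open import Data.Nat.Combinatorics using (_C_)
open import Data.Nat.DivMod
open import Data.Nat.Properties as ℕ using (≤-refl)
open import Data.Product using (∃; _×_; _,_; proj₁; proj₂)
open import Data.Sum using (inj₁; inj₂)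
open import Function using (_∘_; id; _⤖_; _⇔_; mk⇔; module Bijection)
open import Relation.Binary.PropositionalEquality
open import Relation.Nullary using (¬?; does; yes; no; contradiction)

-- The index set ℤ/(k+1)ℤ is Fin (suc k), and `next i` is i + 1 in it.

next : ∀ {k} → Fin (suc k) → Fin (suc k)
next {k} i = suc (toℕ i) mod suc k

residue : ∀ {k} → ℤ → Fin (suc k)
residue {k} z = fromℕ< (n%ℕd<d z (suc k))

record AffinePermutation (k : ℕ) : Set where
  field
    bijection  : ℤ ⤖ ℤ
  open Bijection bijection public using (to)
  field
    periodic   : ∀ z → to (z ℤ.+ + suc k) ≡ to z ℤ.+ + suc k
    normalised : sum-syntax +-0-monoid (suc k) (λ i → to (+ suc (toℕ i)))
                 ≡ + ((k + 2) C 2)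

open AffinePermutation public using (to)

Word : ℕ → Set
Word k = List (Fin (suc k))

s : ∀ {k} → Fin (suc k) → ℤ → ℤ
s i z =
  if does (residue z ≟ i) then z ℤ.+ 1ℤ else
  if does (residue z ≟ next i) then z ℤ.- 1ℤ else
  z

sWord : ∀ {k} → Word k → ℤ → ℤ
sWord = foldr (λ i f → s i ∘ f) id

Reduced : ∀ {k} → Word k → Set
Reduced {k} w = (v : Word k) → sWord v ≗ sWord w → length w ≤ length v

-- The affine nil-Coxeter monoid: expressions in the generators and the zero,
-- up to the congruence generated by the monoid laws and the relations.

infixl 7 _·_
infix  4 _≈_

data NilCoxeter (k : ℕ) : Set where
  a   : Fin (suc k) → NilCoxeter k
  𝟘 ε : NilCoxeter k
  _·_ : NilCoxeter k → NilCoxeter k → NilCoxeter k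

data _≈_ {k : ℕ} : NilCoxeter k → NilCoxeter k → Set where
  ≈-refl    : ∀ {x} → x ≈ x
  ≈-sym     : ∀ {x y} → x ≈ y → y ≈ x
  ≈-trans   : ∀ {x y z} → x ≈ y → y ≈ z → x ≈ z
  ·-cong    : ∀ {x x′ y y′} → x ≈ x′ → y ≈ y′ → x · y ≈ x′ · y′
  ·-assoc   : ∀ x y z → (x · y) · z ≈ x · (y · z)
  identityˡ : ∀ x → ε · x ≈ x
  identityʳ : ∀ x → x · ε ≈ x
  zeroˡ     : ∀ x → 𝟘 · x ≈ 𝟘
  zeroʳ     : ∀ x → x · 𝟘 ≈ 𝟘
  nil       : ∀ i → a i · a i ≈ 𝟘
  commute   : ∀ i j → j ≢ i → j ≢ next i → i ≢ next j → a i · a j ≈ a j · a i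
  braid     : 2 ≤ k → ∀ i →
              a i · a (next i) · a i ≈ a (next i) · a i · a (next i)

aWord : ∀ {k} → Word k → NilCoxeter k
aWord = foldr (λ i t → a i · t) ε

-- t is the nonzero element of the monoid identified with x.

_Represents_ : ∀ {k} → NilCoxeter k → AffinePermutation k → Set
_Represents_ {k} t x =
  ∃ λ (w : Word k) → Reduced w × sWord w ≗ to x × t ≈ aWord w

Proper : ∀ {k} → Subset (suc k) → Set
Proper A = A ⊂ ⊤

-- The defining property of the words for d_A; `next j ∷ j ∷ []` being a
-- sublist of w says that next j occurs to the left of j.

record CyclicallyDecreasing {k} (A : Subset (suc k)) (w : Word k) : Set where
  field
    once    : Unique w
    letters : ∀ i → (i List.∈ w) ⇔ (i ∈ A)
    ordered : ∀ j → j ∈ A → next j ∈ A → (next j ∷ j ∷ []) Sublist.⊆ w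

-- An index outside A when there is one; the value at A = ⊤ is junk.

gap : ∀ {k} → Subset (suc k) → Fin (suc k)
gap A with any? (λ g → ¬? (g ∈? A))
... | yes (g , _) = g
... | no _        = zero

-- The elements of A in the order g - 1, g - 2, …, g + 1, g where g = gap A.

rotate : ∀ {k} → Fin (suc k) → ℕ → Fin (suc k)
rotate {k} g m = (toℕ g + m) mod suc k

dWord : ∀ {k} → Subset (suc k) → Word k
dWord {k} A = filter (_∈? A) (applyDownFrom (rotate (gap A)) (suc k))

d : ∀ {k} → Subset (suc k) → NilCoxeter k
d A = aWord (dWord A)

-- (A₁ , … , Aₙ) ↦ d Aₙ · … · d A₁

dProduct : ∀ {k} → List (Subset (suc k)) → NilCoxeter k
dProduct []       = ε
dProduct (A ∷ As) = dProduct As · d A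

IsDecomposition : ∀ {k} → AffinePermutation k → List (Subset (suc k)) → Set
IsDecomposition x As =
  All (λ A → Nonempty A × Proper A) As × dProduct As Represents x

shape : ∀ {k} → List (Subset (suc k)) → List ℕ
shape = map ∣_∣

infix 4 _≤lex_

_≤lex_ : List ℕ → List ℕ → Set
_≤lex_ = Lex-≤ _≡_ _≤_

IsMaximalDecomposition : ∀ {k} → AffinePermutation k → List (Subset (suc k)) → Set
IsMaximalDecomposition x As =
  IsDecomposition x As × (∀ Bs → IsDecomposition x Bs → shape Bs ≤lex shape As)

-- dWord A satisfies the defining property of the words for d_A.

gap∉ : ∀ {k} {A : Subset (suc k)} → Proper A → gap A ∉ A
gap∉ {A = A} (_ , g , _ , g∉A) with any? (λ g → ¬? (g ∈? A))
... | yes (_ , h∉A) = h∉A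
... | no none       = contradiction (g , g∉A) none

toℕ-mod : ∀ m n → toℕ (m mod suc n) ≡ m % suc n
toℕ-mod m n = toℕ-fromℕ< (m%n<n m (suc n))

mod-cong : ∀ m m′ n → m % suc n ≡ m′ % suc n → m mod suc n ≡ m′ mod suc n
mod-cong m m′ n eq = toℕ-injective
  (trans (toℕ-mod m n) (trans eq (sym (toℕ-mod m′ n))))

toℕ%≡toℕ : ∀ {k} (i : Fin (suc k)) → toℕ i % suc k ≡ toℕ i
toℕ%≡toℕ i = m<n⇒m%n≡m (toℕ<n i)

unrotate : ∀ {k} → Fin (suc k) → Fin (suc k) → ℕ
unrotate {k} g i = (toℕ i + (suc k ∸ toℕ g)) % suc k

unrotate< : ∀ {k} (g i : Fin (suc k)) → unrotate g i < suc k
unrotate< {k} g i = m%n<n (toℕ i + (suc k ∸ toℕ g)) (suc k)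

rotate-cancel : ∀ {k} (g : Fin (suc k)) m →
                (toℕ g + (m + (suc k ∸ toℕ g))) % suc k ≡ m % suc k
rotate-cancel {k} g m = begin
  (toℕ g + (m + c)) % suc k  ≡⟨ cong (_% suc k) (ℕ.+-comm (toℕ g) (m + c)) ⟩
  (m + c + toℕ g) % suc k    ≡⟨ cong (_% suc k) (ℕ.+-assoc m c (toℕ g)) ⟩
  (m + (c + toℕ g)) % suc k  ≡⟨ cong (λ n → (m + n) % suc k) (ℕ.m∸n+n≡m (ℕ.<⇒≤ (toℕ<n g))) ⟩
  (m + suc k) % suc k        ≡⟨ [m+n]%n≡m%n m (suc k) ⟩
  m % suc k                  ∎
  where
  open ≡-Reasoning
  c = suc k ∸ toℕ g

%-absorbʳ : ∀ {k} m n → (m + n % suc k) % suc k ≡ (m + n) % suc k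
%-absorbʳ {k} m n = begin
  (m + n % suc k) % suc k                      ≡⟨ %-distribˡ-+ m (n % suc k) (suc k) ⟩
  (m % suc k + n % suc k % suc k) % suc k      ≡⟨ cong (λ l → (m % suc k + l) % suc k) (m%n%n≡m%n n (suc k)) ⟩
  (m % suc k + n % suc k) % suc k              ≡⟨ %-distribˡ-+ m n (suc k) ⟨
  (m + n) % suc k                              ∎
  where open ≡-Reasoning

%-absorbˡ : ∀ {k} m n → (m % suc k + n) % suc k ≡ (m + n) % suc k
%-absorbˡ {k} m n = begin
  (m % suc k + n) % suc k  ≡⟨ cong (_% suc k) (ℕ.+-comm (m % suc k) n) ⟩
  (n + m % suc k) % suc k  ≡⟨ %-absorbʳ {k} n m ⟩
  (n + m) % suc k          ≡⟨ cong (_% suc k) (ℕ.+-comm n m) ⟩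
  (m + n) % suc k          ∎
  where open ≡-Reasoning

rotate-unrotate : ∀ {k} (g i : Fin (suc k)) → rotate g (unrotate g i) ≡ i
rotate-unrotate {k} g i = toℕ-injective (begin
  toℕ (rotate g (unrotate g i))                    ≡⟨ toℕ-mod (toℕ g + unrotate g i) k ⟩
  (toℕ g + unrotate g i) % suc k                   ≡⟨ %-absorbʳ {k} (toℕ g) (toℕ i + (suc k ∸ toℕ g)) ⟩
  (toℕ g + (toℕ i + (suc k ∸ toℕ g))) % suc k      ≡⟨ rotate-cancel g (toℕ i) ⟩
  toℕ i % suc k                                    ≡⟨ toℕ%≡toℕ i ⟩
  toℕ i                                            ∎)
  where open ≡-Reasoning

unrotate-rotate : ∀ {k} (g : Fin (suc k)) {m} → m < suc k → unrotate g (rotate g m) ≡ m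
unrotate-rotate {k} g {m} m<n = begin
  (toℕ (rotate g m) + c) % suc k        ≡⟨ cong (λ l → (l + c) % suc k) (toℕ-mod (toℕ g + m) k) ⟩
  ((toℕ g + m) % suc k + c) % suc k     ≡⟨ %-absorbˡ {k} (toℕ g + m) c ⟩
  (toℕ g + m + c) % suc k               ≡⟨ cong (_% suc k) (ℕ.+-assoc (toℕ g) m c) ⟩
  (toℕ g + (m + c)) % suc k             ≡⟨ rotate-cancel g m ⟩
  m % suc k                             ≡⟨ m<n⇒m%n≡m m<n ⟩
  m                                     ∎
  where
  open ≡-Reasoning
  c = suc k ∸ toℕ g

next-rotate : ∀ {k} (g : Fin (suc k)) m → next (rotate g m) ≡ rotate g (suc m)
next-rotate {k} g m = mod-cong (suc (toℕ (rotate g m))) (toℕ g + suc m) k (begin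
  (1 + toℕ (rotate g m)) % suc k     ≡⟨ cong (λ l → (1 + l) % suc k) (toℕ-mod (toℕ g + m) k) ⟩
  (1 + (toℕ g + m) % suc k) % suc k  ≡⟨ %-absorbʳ {k} 1 (toℕ g + m) ⟩
  (1 + (toℕ g + m)) % suc k          ≡⟨ cong (_% suc k) (ℕ.+-suc (toℕ g) m) ⟨
  (toℕ g + suc m) % suc k            ∎)
  where open ≡-Reasoning

rotate-full : ∀ {k} (g : Fin (suc k)) → rotate g (suc k) ≡ g
rotate-full {k} g = toℕ-injective
  (trans (toℕ-mod (toℕ g + suc k) k)
    (trans ([m+n]%n≡m%n (toℕ g) (suc k)) (toℕ%≡toℕ g)))

singleton⊆ : ∀ {X : Set} (f : ℕ → X) {m n} → m < n →
             (f m ∷ []) Sublist.⊆ applyDownFrom f n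
singleton⊆ f m<n = Sublist.from∈ (∈-applyDownFrom⁺ f m<n)

consecutive⊆ : ∀ {X : Set} (f : ℕ → X) {m n} → suc m < n →
               (f (suc m) ∷ f m ∷ []) Sublist.⊆ applyDownFrom f n
consecutive⊆ f {m} {suc n} (s≤s m<n) with ℕ.m≤n⇒m<n∨m≡n m<n
... | inj₁ 1+m<n = f n ∷ʳ consecutive⊆ f 1+m<n
... | inj₂ refl  = refl ∷ singleton⊆ f ≤-refl

dWord-cyclicallyDecreasing : ∀ {k} (A : Subset (suc k)) → Proper A →
                             CyclicallyDecreasing A (dWord A)
dWord-cyclicallyDecreasing {k} A A⊂⊤ = record
  { once    = filter⁺ (_∈? A) (applyDownFrom⁺₁ f (suc k) distinct)
  ; letters = λ i → mk⇔ (proj₂ ∘ ∈-filter⁻ (_∈? A) {xs = applyDownFrom f (suc k)})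
                        (∈-filter⁺ (_∈? A) (occurs i))
  ; ordered = λ j j∈A j+1∈A → subst (Sublist._⊆ dWord A)
                (filter-all (_∈? A) (j+1∈A ∷ j∈A ∷ []))
                (Sublist.filter⁺ (_∈? A) (_∈? A) (λ { refl → id }) (adjacent j j+1∈A))
  }
  where
  g = gap A
  f = rotate g

  distinct : ∀ {i j} → j < i → i < suc k → f i ≢ f j
  distinct {i} {j} j<i i<n fi≡fj = ℕ.<⇒≢ j<i (begin
    j                 ≡⟨ unrotate-rotate g (ℕ.<-trans j<i i<n) ⟨
    unrotate g (f j)  ≡⟨ cong (unrotate g) fi≡fj ⟨
    unrotate g (f i)  ≡⟨ unrotate-rotate g i<n ⟩
    i                 ∎)
    where open ≡-Reasoning

  occurs : ∀ i → i List.∈ applyDownFrom f (suc k)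
  occurs i = subst (List._∈ applyDownFrom f (suc k)) (rotate-unrotate g i)
    (∈-applyDownFrom⁺ f (unrotate< g i))

  adjacent-rotate : ∀ {m} → m < suc k → next (f m) ∈ A →
                    (next (f m) ∷ f m ∷ []) Sublist.⊆ applyDownFrom f (suc k)
  adjacent-rotate {m} m<n next∈A with ℕ.m≤n⇒m<n∨m≡n m<n
  ... | inj₁ 1+m<n = subst (λ i → (i ∷ f m ∷ []) Sublist.⊆ applyDownFrom f (suc k))
                       (sym (next-rotate g m)) (consecutive⊆ f 1+m<n)
  ... | inj₂ refl  = contradiction
                       (subst (_∈ A) (trans (next-rotate g k) (rotate-full g)) next∈A)
                       (gap∉ A⊂⊤)

  adjacent : ∀ j → next j ∈ A → (next j ∷ j ∷ []) Sublist.⊆ applyDownFrom f (suc k)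
  adjacent j = subst
    (λ i → next i ∈ A → (next i ∷ i ∷ []) Sublist.⊆ applyDownFrom f (suc k))
    (rotate-unrotate g j) (adjacent-rotate (unrotate< g j))

{-# OPTIONS --safe #-}
module Submission where

open import Defs
open import Data.Bool using (true; if_then_else_)
open import Data.Empty using (⊥)
open import Data.Fin using (Fin; zero; suc; toℕ; fromℕ<; punchIn; _≟_)
open import Data.Fin.Properties
  using (any?; toℕ<n; toℕ-fromℕ<; toℕ-injective; punchInᵢ≢i)
open import Data.Fin.Subset using (Subset; Nonempty; _∈_; _∉_; _⊆_; _⊂_; ∣_∣)
open import Data.Fin.Subset.Properties
  using (_∈?_; ∈⊤; nonempty?; ⊆-antisym; p⊂q⇒∣p∣<∣q∣)
open import Data.Integer as ℤ using (ℤ; +_; 0ℤ; 1ℤ; _+_; _-_; _*_)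
open import Data.Integer.DivMod using (_%ℕ_; _/ℕ_; a≡a%ℕn+[a/ℕn]*n; n%ℕd<d)
import Data.Integer.Properties as ℤ
open import Algebra.Properties.CommutativeMonoid.Sum ℤ.+-0-commutativeMonoid
  using (sum; sum-remove; sum-cong-≗)
open import Data.Integer.Tactic.RingSolver using (solve-∀)
open import Data.List using (List; []; _∷_; [_]; _++_; length; filter; applyDownFrom)
import Data.List.Membership.Propositional as List
open import Data.List.Properties
  using (length-++; ++-assoc; ++-identityʳ; filter-accept; filter-reject)
open import Data.List.Relation.Binary.Lex.NonStrict as Lex using (base; halt; this)
open import Data.List.Relation.Unary.All using (All; []; _∷_)
open import Data.List.Relation.Unary.Any using (here; there)
open import Data.Nat as ℕ using (ℕ; zero; suc; _≤_; _<_; _∸_; z≤n; s≤s)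
open import Data.Nat.Combinatorics using (_C_; nCk+nC[k+1]≡[n+1]C[k+1]; nC1≡n)
open import Data.Nat.Divisibility using (divides; ∣⇒≤)
import Data.Nat.Properties as ℕ
open import Data.Product using (∃; ∃!; _×_; _,_; proj₁; proj₂)
open import Data.Sum using (_⊎_; inj₁; inj₂)
open import Data.Unit using (tt)
open import Data.Vec using (tabulate; lookup)
open import Data.Vec.Functional using (updateAt)
open import Data.Vec.Functional.Properties using (updateAt-updates; updateAt-minimal)
open import Data.Vec.Properties using (lookup∘tabulate; []=⇒lookup; lookup⇒[]=)
open import Function using (_∘_; id; const; _⇔_; mk⇔; Equivalence; module Bijection)
open import Relation.Binary.Definitions using (tri<; tri≈; tri>)
open import Relation.Binary.PropositionalEquality hiding ([_])
open import Relation.Nullary using (Dec; yes; no; contradiction; ¬_; ¬?; does; _×-dec_)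
open import Relation.Nullary.Decidable using (dec-true; dec-false; decidable-stable)

-- Position i + 1 of an affine permutation f is covered if a larger value stands to its
-- left.  If d A is a right factor of f then A consists of indices i with i + 1 covered:
-- undoing the letters of d A one by one from a gap of A carries a value to the right, past
-- smaller ones only, and this value comes from further left.  Conversely the set C of all
-- these i is proper, since a periodic f has left-to-right maxima, and d C is a right factor,
-- the value carried along now being the running maximum.  So C is the largest index set of
-- a right factor, and all others are strictly contained in it; peeling off d C repeatedly
-- gives the unique decomposition of lexicographically maximal shape.

-- The monoid is given by a presentation, so neither the nonvanishing of a product nor the equality
-- of two products can be read off from an expression. Both are transferred to maps on ℤ by a
-- partial right action that respects `_≈_`: a letter may be applied only at an ascent, so the
-- action of a word on `id` is defined precisely for reduced words. A right factor `d A` of `f` then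
-- means a map `h` with `h ⟨ d A ⟩⇒ f`, and `h` is determined up to `_≗_` because words act by
-- bijections. Hence decompositions starting with the same set continue from the same map, while a
-- strictly smaller set loses lexicographically at once. The peeling can end only at the identity:
-- an affine map without covered indices is a translation, and the sum in `normalised` excludes
-- every translation but the trivial one.

-- Integer inequalities and finite sums

-- Reduces a linear inequality to an identity between differences, which the ring solver can check.
≤-by : ∀ {i b c e} → i ℤ.≤ b → b - i ≡ e - c → c ℤ.≤ e
≤-by i≤b eq = ℤ.0≤i-j⇒j≤i (subst (ℤ.0ℤ ℤ.≤_) eq (ℤ.i≤j⇒0≤j-i i≤b))

<⇒+1≤ : ∀ {i b} → i ℤ.< b → i + 1ℤ ℤ.≤ b
<⇒+1≤ {i} {b} i<b = subst (ℤ._≤ b) (ℤ.+-comm 1ℤ i) (ℤ.i<j⇒suc[i]≤j i<b)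

+1≤⇒< : ∀ {i b} → i + 1ℤ ℤ.≤ b → i ℤ.< b
+1≤⇒< {i} {b} le = ℤ.suc[i]≤j⇒i<j (subst (ℤ._≤ b) (ℤ.+-comm i 1ℤ) le)

<+1⇒≤ : ∀ {i b} → i ℤ.< b + 1ℤ → i ℤ.≤ b
<+1⇒≤ {i} {b} i<b+1 = ≤-by (<⇒+1≤ i<b+1) (lem i b)
  where
  lem : ∀ i b → (b + 1ℤ) - (i + 1ℤ) ≡ b - i
  lem = solve-∀

i<i+1 : ∀ i → i ℤ.< i + 1ℤ
i<i+1 i = +1≤⇒< ℤ.≤-refl

<-by : ∀ {i b c e} → i ℤ.< b → b - i ≡ e - c → c ℤ.< e
<-by {i} {b} {c} {e} i<b eq = +1≤⇒< (≤-by (<⇒+1≤ i<b)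
  (trans (lem i b) (trans (cong (_- 1ℤ) eq) (sym (lem c e)))))
  where
  lem : ∀ i b → b - (i + 1ℤ) ≡ (b - i) - 1ℤ
  lem = solve-∀

+-cancelʳ : ∀ {i b} c → i + c ≡ b + c → i ≡ b
+-cancelʳ {i} {b} c eq = trans (sym (lem i c)) (trans (cong (_- c) eq) (lem b c))
  where
  lem : ∀ i c → (i + c) - c ≡ i
  lem = solve-∀

pred+1 : ∀ z → z ≡ (z - 1ℤ) + 1ℤ
pred+1 = solve-∀

+-swapʳ : ∀ x y z → x + y + z ≡ x + z + y
+-swapʳ = solve-∀

argmax : ∀ (F : ℕ → ℤ) n → ∃ λ m → m ≤ n × (∀ t → t ≤ n → F t ℤ.≤ F m)
argmax F zero = 0 , z≤n , λ { zero z≤n → ℤ.≤-refl }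
argmax F (suc n) with argmax F n
... | m , m≤n , max with ℤ.≤-total (F m) (F (suc n))
...   | inj₁ le = suc n , ℕ.≤-refl , λ t t≤ → bound t (ℕ.m≤n⇒m<n∨m≡n t≤)
  where
  bound : ∀ t → _ → F t ℤ.≤ F (suc n)
  bound t (inj₁ t<) = ℤ.≤-trans (max t (ℕ.≤-pred t<)) le
  bound t (inj₂ refl) = ℤ.≤-refl
...   | inj₂ ge = m , ℕ.m≤n⇒m≤1+n m≤n , λ t t≤ → bound t (ℕ.m≤n⇒m<n∨m≡n t≤)
  where
  bound : ∀ t → _ → F t ℤ.≤ F m
  bound t (inj₁ t<) = max t (ℕ.≤-pred t<)
  bound t (inj₂ refl) = ge

sum-change : ∀ {n} {t u : Fin n → ℤ} i → (∀ j → j ≢ i → t j ≡ u j) → sum t - t i ≡ sum u - u i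
sum-change {suc n} {t} {u} i same = trans (cong (_- t i) (sum-remove {i = i} t))
  (trans (lem (t i) _)
  (trans (sum-cong-≗ λ j → same (punchIn i j) (punchInᵢ≢i i j))
    (sym (trans (cong (_- u i) (sum-remove {i = i} u)) (lem (u i) _)))))
  where
  lem : ∀ x y → x + y - x ≡ y
  lem = solve-∀

-- The two entries are changed one at a time: `v` is `t` with only the entry at `i` replaced by that
-- of `u`.
sum-change₂ : ∀ {n} {t u : Fin n → ℤ} {i j} → i ≢ j → (∀ l → l ≢ i → l ≢ j → t l ≡ u l) →
              sum t - (t i + t j) ≡ sum u - (u i + u j)
sum-change₂ {t = t} {u} {i} {j} i≢j same = trans (lem₁ (sum t) (t i) (t j))
  (trans (cong (_- t j) (sum-change i (λ l l≢i → sym (updateAt-minimal l i t l≢i))))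
   (trans (cong₂ (λ x y → sum v - x - y) (updateAt-updates i t)
     (sym (updateAt-minimal j i t (i≢j ∘ sym))))
   (trans (lem₂ (sum v) (u i) (v j)) (trans (cong (_- u i) (sum-change j agree))
     (lem₃ (sum u) (u i) (u j))))))
  where
  v = updateAt t i (const (u i))
  agree : ∀ l → l ≢ j → v l ≡ u l
  agree l l≢j with l ≟ i
  ... | yes refl = updateAt-updates i t
  ... | no l≢i   = trans (updateAt-minimal l i t l≢i) (same l l≢i l≢j)
  lem₁ : ∀ x y z → x - (y + z) ≡ x - y - z
  lem₁ = solve-∀
  lem₂ : ∀ x y z → x - y - z ≡ x - z - y
  lem₂ = solve-∀
  lem₃ : ∀ x y z → x - z - y ≡ x - (y + z)
  lem₃ = solve-∀

sum-minus : ∀ {n} (t u : Fin n → ℤ) → sum (λ i → t i - u i) ≡ sum t - sum u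
sum-minus {zero} t u = refl
sum-minus {suc n} t u = trans (cong (_+_ (t zero - u zero)) (sum-minus (t ∘ suc) (u ∘ suc)))
  (lem (t zero) (u zero) (sum (t ∘ suc)) (sum (u ∘ suc)))
  where
  lem : ∀ w x y z → w - x + (y - z) ≡ w + y - (x + z)
  lem = solve-∀

sum-const : ∀ n x → sum {n} (const x) ≡ + n * x
sum-const zero x = refl
sum-const (suc n) x = trans (cong (_+_ x) (sum-const n x)) (lem (+ n) x)
  where
  lem : ∀ n x → x + n * x ≡ (1ℤ + n) * x
  lem = solve-∀

sum-nonNeg : ∀ {n} (t : Fin n → ℤ) → (∀ i → 0ℤ ℤ.≤ t i) → 0ℤ ℤ.≤ sum t
sum-nonNeg {zero}  t 0≤t = ℤ.≤-refl
sum-nonNeg {suc n} t 0≤t = ℤ.+-mono-≤ (0≤t zero) (sum-nonNeg (t ∘ suc) (0≤t ∘ suc))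

-- The offset `m` is general because splitting off the first term raises it by one; Pascal's rule
-- absorbs that term. With `m = 1`, where `m C 2` is 0, this evaluates the window sum of the
-- identity for comparison with `normalised`.
sum-range : ∀ n m → sum {n} (λ i → + (m ℕ.+ toℕ i)) + + (m C 2) ≡ + ((m ℕ.+ n) C 2)
sum-range zero m = cong (λ l → + (l C 2)) (sym (ℕ.+-identityʳ m))
sum-range (suc n) m = begin
  sum {suc n} (λ i → + (m ℕ.+ toℕ i)) + + (m C 2)  ≡⟨ cong (λ x → x + S′ + + (m C 2)) (cong +_ (ℕ.+-identityʳ m)) ⟩
  + m + S′ + + (m C 2)                             ≡⟨ cong (λ x → + m + x + + (m C 2)) S′≡S ⟩
  + m + S + + (m C 2)                              ≡⟨ lem (+ m) S (+ (m C 2)) ⟩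
  S + + (m ℕ.+ m C 2)                              ≡⟨ cong (λ x → S + + x) pascal ⟩
  S + + (suc m C 2)                                ≡⟨ sum-range n (suc m) ⟩
  + ((suc m ℕ.+ n) C 2)                            ≡⟨ cong (λ l → + (l C 2)) (ℕ.+-suc m n) ⟨
  + ((m ℕ.+ suc n) C 2)                            ∎
  where
  open ≡-Reasoning
  S  = sum {n} (λ i → + (suc m ℕ.+ toℕ i))
  S′ = sum {n} (λ i → + (m ℕ.+ suc (toℕ i)))
  S′≡S : S′ ≡ S
  S′≡S = sum-cong-≗ {n} λ i → cong +_ (ℕ.+-suc m (toℕ i))
  lem : ∀ x y z → x + y + z ≡ y + (x + z)
  lem = solve-∀
  pascal : m ℕ.+ m C 2 ≡ suc m C 2
  pascal = trans (cong (ℕ._+ m C 2) (sym (nC1≡n m))) (nCk+nC[k+1]≡[n+1]C[k+1] m 1)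

0≤i*i : ∀ i → 0ℤ ℤ.≤ i * i
0≤i*i i@(+ _)      = subst (0ℤ ℤ.≤_) (ℤ.pos-* ℤ.∣ i ∣ ℤ.∣ i ∣) (ℤ.+≤+ z≤n)
0≤i*i ℤ.-[1+ n ] = ℤ.+≤+ z≤n

-- Subsets and words

⊆⇒≡⊎⊂ : ∀ {n} {A B : Subset n} → A ⊆ B → A ≡ B ⊎ A ⊂ B
⊆⇒≡⊎⊂ {A = A} {B} A⊆B with any? (λ i → (i ∈? B) ×-dec ¬? (i ∈? A))
... | yes (i , i∈B , i∉A) = inj₂ (A⊆B , i , i∈B , i∉A)
... | no none = inj₁ (⊆-antisym A⊆B (λ {i} i∈B → decidable-stable (i ∈? A)
    (λ i∉A → none (i , i∈B , i∉A))))

NonemptyProper : ∀ {k} → Subset (suc k) → Set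
NonemptyProper A = Nonempty A × Proper A

aWord-++ : ∀ {k} (u w : Word k) → aWord (u ++ w) ≈ aWord u · aWord w
aWord-++ []      w = ≈-sym (identityˡ _)
aWord-++ (i ∷ u) w = ≈-trans (·-cong ≈-refl (aWord-++ u w)) (≈-sym (·-assoc _ _ _))

dWords : ∀ {k} → List (Subset (suc k)) → Word k
dWords []       = []
dWords (A ∷ As) = dWords As ++ dWord A

dProduct≈ : ∀ {k} (As : List (Subset (suc k))) → dProduct As ≈ aWord (dWords As)
dProduct≈ []       = ≈-refl
dProduct≈ (A ∷ As) = ≈-trans (·-cong (dProduct≈ As) ≈-refl) (≈-sym (aWord-++ (dWords As) (dWord A)))

module _ {k : ℕ} where

  -- Residues

  period : ℤ
  period = + suc k

  -- Two remainders differ by less than `k + 1` in absolute value, so if their difference is a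
  -- multiple of `k + 1` the quotient is zero.
  residue-unique : ∀ {z} (r : Fin (suc k)) c → z ≡ + toℕ r + c * period → residue z ≡ r
  residue-unique {z} r c eq = toℕ-injective (trans (toℕ-fromℕ< (n%ℕd<d z (suc k)))
    (same m r′ (q - c) diff (n%ℕd<d z (suc k)) (toℕ<n r)))
    where
    m = z %ℕ suc k
    q = z /ℕ suc k
    r′ = toℕ r
    lem : ∀ r q c m n → r + c * n ≡ m + q * n → r - m ≡ (q - c) * n
    lem r q c m n e = trans (lem₁ r c m n) (trans (cong (λ x → x - c * n - m) e) (lem₂ q c m n))
      where
      lem₁ : ∀ r c m n → r - m ≡ (r + c * n) - c * n - m
      lem₁ = solve-∀
      lem₂ : ∀ q c m n → (m + q * n) - c * n - m ≡ (q - c) * n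
      lem₂ = solve-∀
    diff : + r′ - + m ≡ (q - c) * period
    diff = lem (+ r′) q c (+ m) period (trans (sym eq) (a≡a%ℕn+[a/ℕn]*n z (suc k)))
    same : ∀ m r q → + r - + m ≡ q * period → m < suc k → r < suc k → m ≡ r
    same m r q eq m< r< = sym (ℤ.+-injective (ℤ.i-j≡0⇒i≡j (+ r) (+ m)
      (trans eq (cong (_* period) (ℤ.∣i∣≡0⇒i≡0 {q} (zero-quot ℤ.∣ q ∣ small))))))
      where
      zero-quot : ∀ p → p ℕ.* suc k < suc k → p ≡ 0
      zero-quot 0 _ = refl
      zero-quot (suc p) lt = contradiction lt (ℕ.≤⇒≯ (ℕ.m≤m+n (suc k) (p ℕ.* suc k)))
      small : ℤ.∣ q ∣ ℕ.* suc k < suc k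
      small = subst (_< suc k) (trans (cong ℤ.∣_∣ (trans (sym (ℤ.m-n≡m⊖n r m)) eq))
        (ℤ.∣i*j∣≡∣i∣*∣j∣ q period))
                (s≤s (ℕ.≤-trans (ℤ.∣m⊝n∣≤m⊔n r m) (ℕ.⊔-lub (ℕ.≤-pred r<) (ℕ.≤-pred m<))))

  residue-expand : ∀ z → z ≡ + toℕ (residue {k} z) + (z /ℕ suc k) * period
  residue-expand z = trans (a≡a%ℕn+[a/ℕn]*n z (suc k))
    (cong (λ r → + r + (z /ℕ suc k) * period) (sym (toℕ-fromℕ< (n%ℕd<d z (suc k)))))

  residue-shift : ∀ c z → residue (z + c * period) ≡ residue z
  residue-shift c z = residue-unique (residue z) (q + c)
    (trans (cong (_+ c * period) (residue-expand z)) (lem (+ toℕ (residue {k} z)) q c period))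
    where
    q = z /ℕ suc k
    lem : ∀ r q c n → r + q * n + c * n ≡ r + (q + c) * n
    lem = solve-∀

  residue-toℕ : ∀ r → residue (+ toℕ r) ≡ r
  residue-toℕ r = residue-unique r ℤ.0ℤ (sym (ℤ.+-identityʳ (+ toℕ r)))

  residue-congruent : ∀ {y z} → residue y ≡ residue z → ∃ λ c → z ≡ y + c * period
  residue-congruent {y} {z} eq = q′ - q , trans (residue-expand z)
    (trans (cong (λ r → + toℕ r + q′ * period) (sym eq))
    (trans (lem (+ toℕ (residue {k} y)) q q′ period)
      (cong (_+ (q′ - q) * period) (sym (residue-expand y)))))
    where
    q = y /ℕ suc k
    q′ = z /ℕ suc k
    lem : ∀ r q q′ n → r + q′ * n ≡ r + q * n + (q′ - q) * n
    lem = solve-∀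

  residue-suc : ∀ z → residue (z + 1ℤ) ≡ next (residue z)
  residue-suc z = trans (cong residue step) (residue-shift q (+ suc r))
    where
    q = z /ℕ suc k
    r = toℕ (residue {k} z)
    lem : ∀ r q n → r + q * n + 1ℤ ≡ (1ℤ + r) + q * n
    lem = solve-∀
    step : z + 1ℤ ≡ + suc r + q * period
    step = trans (cong (_+ 1ℤ) (residue-expand z)) (lem (+ r) q period)

  residue-suc-injective : ∀ {y z} → residue (y + 1ℤ) ≡ residue (z + 1ℤ) → residue y ≡ residue z
  residue-suc-injective {y} {z} eq with residue-congruent {y + 1ℤ} {z + 1ℤ} eq
  ... | c , z+1≡ = sym (trans (cong residue (+-cancelʳ {z} {y + c * period} 1ℤ
      (trans z+1≡ (lem y (c * period))))) (residue-shift c y))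
    where
    lem : ∀ y c → y + 1ℤ + c ≡ y + c + 1ℤ
    lem = solve-∀

  prev : Fin (suc k) → Fin (suc k)
  prev i = rotate i k

  next-prev : ∀ i → next (prev i) ≡ i
  next-prev i = trans (next-rotate i k) (rotate-full i)

  next-injective : ∀ {i j : Fin (suc k)} → next i ≡ next j → i ≡ j
  next-injective {i} {j} eq = trans (sym (residue-toℕ i))
    (trans (residue-suc-injective {+ toℕ i} {+ toℕ j}
     (trans (residue-suc (+ toℕ i)) (trans (cong next (residue-toℕ i))
       (trans eq (trans (sym (cong next (residue-toℕ j))) (sym (residue-suc (+ toℕ j))))))))
       (residue-toℕ j))

  residue-+-≢ : ∀ z m → suc m ≤ k → residue {k} (z + + suc m) ≢ residue z
  residue-+-≢ z m m<k eq with residue-congruent {z} {z + + suc m} (sym eq)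
  ... | c , z+m≡ = ℕ.<⇒≱ m<k (ℕ.≤-pred (∣⇒≤ (divides ℤ.∣ c ∣
      (trans (cong ℤ.∣_∣ m≡cN) (ℤ.∣i*j∣≡∣i∣*∣j∣ c period)))))
    where
    m≡cN : + suc m ≡ c * period
    m≡cN = +-cancelʳ {+ suc m} {c * period} z (trans (ℤ.+-comm (+ suc m) z)
      (trans z+m≡ (ℤ.+-comm z (c * period))))

  next-≢ : 1 ≤ k → (i : Fin (suc k)) → next i ≢ i
  next-≢ 1≤k i eq = residue-+-≢ (+ toℕ i) 0 1≤k
    (trans (residue-suc (+ toℕ i)) (trans (cong next (residue-toℕ i))
      (trans eq (sym (residue-toℕ i)))))

  next-next-≢ : 2 ≤ k → (i : Fin (suc k)) → next (next i) ≢ i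
  next-next-≢ 2≤k i eq = residue-+-≢ (+ toℕ i) 1 2≤k
    (trans (trans (cong residue (sym (ℤ.+-assoc (+ toℕ i) 1ℤ 1ℤ)))
      (trans (residue-suc (+ toℕ i + 1ℤ)) (cong next (residue-suc (+ toℕ i)))))
    (trans (cong (next ∘ next) (residue-toℕ i)) (trans eq (sym (residue-toℕ i)))))

  -- Generators as maps on ℤ and the partial action

  s-up : ∀ {i} z → residue z ≡ i → s {k} i z ≡ z + 1ℤ
  s-up {i} z p = cong (λ b → if b then z + 1ℤ else
    (if does (residue z ≟ next i) then z - 1ℤ else z)) (dec-true (residue z ≟ i) p)

  s-fix : ∀ {i} z → residue z ≢ i → residue z ≢ next i → s {k} i z ≡ z
  s-fix {i} z p q = trans (cong (λ b → if b then z + 1ℤ else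
    (if does (residue z ≟ next i) then z - 1ℤ else z)) (dec-false (residue z ≟ i) p))
     (cong (λ b → if b then z - 1ℤ else z) (dec-false (residue z ≟ next i) q))

  Ascent : (ℤ → ℤ) → Fin (suc k) → Set
  Ascent f i = ∀ z → residue z ≡ i → f z ℤ.< f (z + 1ℤ)

  -- Partial right multiplication: f · a i is f ∘ s i if f increases at the positions
  -- of residue i, and is undefined (zero) otherwise.  Starting from id it is defined
  -- along a word iff the word is reduced, see reduced⇒ and ⇒reduced.
  infix 4 _⟨_⟩⇒_
  _⟨_⟩⇒_ : (ℤ → ℤ) → NilCoxeter k → (ℤ → ℤ) → Set
  f ⟨ a i ⟩⇒ g   = Ascent f i × g ≗ f ∘ s i
  f ⟨ 𝟘 ⟩⇒ g     = ⊥
  f ⟨ ε ⟩⇒ g     = g ≗ f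
  f ⟨ x · y ⟩⇒ g = ∃ λ h → f ⟨ x ⟩⇒ h × h ⟨ y ⟩⇒ g

  ⇒-resp : ∀ t {f f′ g g′} → f ≗ f′ → g ≗ g′ → f ⟨ t ⟩⇒ g → f′ ⟨ t ⟩⇒ g′
  ⇒-resp (a i) f≗ g≗ (asc , eq) =
    (λ z r → subst₂ ℤ._<_ (f≗ z) (f≗ (z + 1ℤ)) (asc z r)) ,
    (λ z → trans (sym (g≗ z)) (trans (eq z) (f≗ (s i z))))
  ⇒-resp ε f≗ g≗ eq = λ z → trans (sym (g≗ z)) (trans (eq z) (f≗ z))
  ⇒-resp (x · y) f≗ g≗ (h , p , q) = h , ⇒-resp x f≗ (λ _ → refl) p , ⇒-resp y (λ _ → refl) g≗ q

  -- Affine maps and their covered indices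

  -- Periodicity covers all integer multiples of the period at once, since `residue-congruent`
  -- delivers an arbitrary integer `c`.
  record Affine (f : ℤ → ℤ) : Set where
    field
      periodic  : ∀ c z → f (z + c * period) ≡ f z + c * period
      injective : ∀ {y z} → f y ≡ f z → y ≡ z

  open Affine

  sWord-++ : ∀ u w → sWord {k} (u ++ w) ≗ sWord u ∘ sWord w
  sWord-++ []      w z = refl
  sWord-++ (i ∷ u) w z = cong (s i) (sWord-++ u w z)

  -- f (z + 1) is not a left-to-right maximum of f.  As f (z - (k + 1)) is
  -- f z - (k + 1), only the k + 1 values before it matter.
  Covered : (ℤ → ℤ) → ℤ → Set
  Covered f z = ∃ λ (t : Fin (suc k)) → f (z + 1ℤ) ℤ.< f (z - + toℕ t)

  covered? : ∀ f z → Dec (Covered f z)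
  covered? f z = any? (λ t → f (z + 1ℤ) ℤ.<? f (z - + toℕ t))

  coveredSet : (ℤ → ℤ) → Subset (suc k)
  coveredSet f = tabulate (λ i → does (covered? f (+ toℕ i)))

  lookup-covered : ∀ f i → lookup (coveredSet f) i ≡ does (covered? f (+ toℕ i))
  lookup-covered f i = lookup∘tabulate (λ i → does (covered? f (+ toℕ i))) i

  periodic-< : ∀ {f} → Affine f → ∀ {x y} c → f x ℤ.< f y →
               f (x + c * period) ℤ.< f (y + c * period)
  periodic-< F {x} {y} c lt = subst₂ ℤ._<_ (sym (periodic F c x)) (sym (periodic F c y))
    (ℤ.+-monoˡ-< (c * period) lt)

  covered-shift : ∀ {f} → Affine f → ∀ y c → Covered f y → Covered f (y + c * period)
  covered-shift {f} F y c (t , lt) = t , subst₂ (λ u v → f u ℤ.< f v)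
    (+-swapʳ y 1ℤ (c * period)) (+-swapʳ y (ℤ.- + toℕ t) (c * period)) (periodic-< F c lt)

  ∈covered⁺ : ∀ {f} → Affine f → ∀ {z} → Covered f z → residue z ∈ coveredSet f
  ∈covered⁺ {f} F {z} cov with residue-congruent {z} {+ toℕ (residue {k} z)}
    (sym (residue-toℕ (residue z)))
  ... | c , eq = lookup⇒[]= (residue z) (coveredSet f) (trans (lookup-covered f (residue {k} z))
    (dec-true (covered? f (+ toℕ (residue {k} z)))
      (subst (Covered f) (sym eq) (covered-shift F z c cov))))

  ∈covered⁻ : ∀ {f} → Affine f → ∀ z → residue z ∈ coveredSet f → Covered f z
  ∈covered⁻ {f} F z i∈C with residue-congruent {+ toℕ (residue {k} z)} {z} (residue-toℕ (residue z))
  ... | c , eq = subst (Covered f) (sym eq) (covered-shift F (+ toℕ (residue {k} z)) c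
    (from (covered? f (+ toℕ (residue {k} z))) (trans (sym (lookup-covered f (residue {k} z)))
      ([]=⇒lookup i∈C))))
    where
    from : ∀ {P : Set} (d? : Dec P) → does d? ≡ true → P
    from (yes p) _ = p

  ascent : ∀ {f z} → Affine f → f z ℤ.< f (z + 1ℤ) → Ascent f (residue z)
  ascent {f} {z} F lt y r with residue-congruent {z} {y} (sym r)
  ... | c , refl = subst (f (z + c * period) ℤ.<_) (cong f (+-swapʳ z 1ℤ (c * period)))
      (periodic-< F c lt)

  -- Let `f` be maximal at `m` among 0, ..., k. Each of the k + 1 positions before `m` lies in this
  -- window or one period to the left of it, where the value is a window value less `k + 1`. So none
  -- of them exceeds `f (+ m)`, and the index of `m - 1` is not covered.
  covered-proper : ∀ {f} → Affine f → Proper (coveredSet f)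
  covered-proper {f} F with argmax (λ t → f (+ t)) k
  ... | m , m≤k , max = (λ _ → ∈⊤) , residue z , ∈⊤ , λ i∈C →
      let t , lt = ∈covered⁻ F z i∈C
      in contradiction (bound t) (ℤ.<⇒≱ (subst (λ y → f y ℤ.< f (z - + toℕ t)) (sym (pred+1 (+ m))) lt))
    where
    z = + m - 1ℤ
    back : ∀ m t → m - 1ℤ - t ≡ m - (1ℤ + t)
    back = solve-∀
    wrap : ∀ m n t → m - 1ℤ - t ≡ (m + n - (1ℤ + t)) + ℤ.- 1ℤ * n
    wrap = solve-∀
    bound : ∀ (t : Fin (suc k)) → f (z - + toℕ t) ℤ.≤ f (+ m)
    bound t with suc (toℕ t) ℕ.≤? m
    ... | yes t<m = subst (λ y → f y ℤ.≤ f (+ m))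
          (sym (trans (back (+ m) (+ toℕ t)) (trans (ℤ.m-n≡m⊖n m (suc (toℕ t))) (ℤ.⊖-≥ t<m))))
          (max (m ∸ suc (toℕ t)) (ℕ.≤-trans (ℕ.m∸n≤m m (suc (toℕ t))) m≤k))
    ... | no t≮m = subst (λ y → f y ℤ.≤ f (+ m)) (sym eq)
          (ℤ.≤-trans (ℤ.≤-reflexive (trans (periodic F (ℤ.- 1ℤ) (+ w))
            (cong (λ x → f (+ w) + x) (ℤ.-1*i≡-i period))))
          (ℤ.≤-trans (ℤ.i-j≤i (f (+ w)) period) (max w w≤k)))
      where
      w = m ℕ.+ suc k ∸ suc (toℕ t)
      w≤k : w ≤ k
      w≤k = ℕ.m≤n+o⇒m∸n≤o (m ℕ.+ suc k) (suc (toℕ t))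
        (subst (_≤ suc (toℕ t) ℕ.+ k) (sym (ℕ.+-suc m k))
        (s≤s (ℕ.+-monoˡ-≤ k (ℕ.≤-pred (ℕ.≰⇒> t≮m)))))
      eq : z - + toℕ t ≡ + w + ℤ.- 1ℤ * period
      eq = trans (wrap (+ m) period (+ toℕ t)) (cong (_+ ℤ.- 1ℤ * period)
        (trans (ℤ.m-n≡m⊖n (m ℕ.+ suc k) (suc (toℕ t)))
             (ℤ.⊖-≥ (ℕ.≤-trans (toℕ<n t) (ℕ.m≤n+m (suc k) m)))))

  -- Displacements and energy

  displacement : (ℤ → ℤ) → ℤ → ℤ
  displacement f z = f z - z

  displacement-shift : ∀ {f} → Affine f → ∀ c z → displacement f (z + c * period) ≡ displacement f z
  displacement-shift {f} F c z = trans (cong (_- (z + c * period)) (periodic F c z))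
    (lem (f z) (c * period) z)
    where
    lem : ∀ x c z → x + c - (z + c) ≡ x - z
    lem = solve-∀

  displacement-cong : ∀ {f} → Affine f → ∀ {y z} → residue {k} y ≡ residue z → displacement f y
    ≡ displacement f z
  displacement-cong {f} F {y} {z} eq with residue-congruent {y} {z} eq
  ... | c , refl = sym (displacement-shift F c y)

  -- The index i stands for the position i + 1 (as in `normalised`), of residue next i.
  window : (ℤ → ℤ) → Fin (suc k) → ℤ
  window f i = displacement f (+ suc (toℕ i))

  total : (ℤ → ℤ) → ℤ
  total f = sum (window f)

  -- Replaces the length as a termination measure: undoing a letter swaps adjacent
  -- displacements p ≤ q (up to 1) and lowers the sum of squares by 2 (q - p) + 2.
  energy : (ℤ → ℤ) → ℤ
  energy f = sum (λ i → window f i * window f i)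

  window-cong : ∀ {f g} → f ≗ g → window f ≗ window g
  window-cong f≗g i = cong (_- (+ suc (toℕ i))) (f≗g (+ suc (toℕ i)))

  energy-nonNeg : ∀ f → 0ℤ ℤ.≤ energy f
  energy-nonNeg f = sum-nonNeg (λ i → window f i * window f i) (λ i → 0≤i*i (window f i))

  affine-resp : ∀ {f g} → f ≗ g → Affine f → Affine g
  affine-resp {f} {g} f≗g F = record
    { periodic  = λ c z → trans (sym (f≗g _)) (trans (periodic F c z)
      (cong (_+ c * period) (f≗g z)))
    ; injective = λ eq → injective F (trans (f≗g _) (trans eq (sym (f≗g _))))
    }

  -- Without covered indices `f` is increasing, so its displacement is nondecreasing. Being periodic
  -- as well, it is constant, and the total forces the constant to be zero.
  uncovered⇒id : ∀ {f} → Affine f → total f ≡ 0ℤ → ¬ Nonempty (coveredSet f) → f ≗ id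
  uncovered⇒id {f} F sum≡0 empty z = ℤ.i-j≡0⇒i≡j (f z) z
    (trans (displacement-cong F (sym (residue-toℕ (residue z))))
    (trans (constant (toℕ (residue {k} z))) vanishes))
    where
    step : ∀ z → displacement f z ℤ.≤ displacement f (z + 1ℤ)
    step z = ≤-by (<⇒+1≤ (ℤ.≤∧≢⇒< le λ eq → ℤ.<-irrefl (injective F eq) (i<i+1 z)))
      (lem (f z) (f (z + 1ℤ)) z)
      where
      le : f z ℤ.≤ f (z + 1ℤ)
      le = ℤ.≮⇒≥ λ lt → empty (residue z , ∈covered⁺ F {z}
        (zero , subst (λ y → f (z + 1ℤ) ℤ.< f y) (sym (ℤ.+-identityʳ z)) lt))
      lem : ∀ x y z → y - (x + 1ℤ) ≡ (y - (z + 1ℤ)) - (x - z)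
      lem = solve-∀

    steps : ∀ m z → displacement f z ℤ.≤ displacement f (z + + m)
    steps zero    z = ℤ.≤-reflexive (cong (displacement f) (sym (ℤ.+-identityʳ z)))
    steps (suc m) z = ℤ.≤-trans (step z) (subst (λ y → displacement f (z + 1ℤ) ℤ.≤ displacement
      f y) (ℤ.+-assoc z 1ℤ (+ m)) (steps m (z + 1ℤ)))

    step-≡ : ∀ z → displacement f (z + 1ℤ) ≡ displacement f z
    step-≡ z = ℤ.≤-antisym (ℤ.≤-trans (steps k (z + 1ℤ))
      (ℤ.≤-reflexive (trans (cong (displacement f) (lem z (+ k))) (displacement-shift F 1ℤ z))))
      (step z)
      where
      lem : ∀ z k → z + 1ℤ + k ≡ z + 1ℤ * (1ℤ + k)
      lem = solve-∀

    constant : ∀ m → displacement f (+ m) ≡ displacement f 0ℤ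
    constant zero    = refl
    constant (suc m) = trans (cong (displacement f ∘ +_) (ℕ.+-comm 1 m))
      (trans (step-≡ (+ m)) (constant m))

    vanishes : displacement f 0ℤ ≡ 0ℤ
    vanishes = ℤ.*-cancelˡ-≡ period (displacement f 0ℤ) 0ℤ
      (trans (sym (sum-const (suc k) (displacement f 0ℤ)))
      (trans (sum-cong-≗ {suc k} (λ i → sym (constant (suc (toℕ i)))))
        (trans sum≡0 (sym (ℤ.*-zeroʳ period)))))

  -- Affine permutations

  permutation-affine : (x : AffinePermutation k) → Affine (to x)
  permutation-affine x = record { periodic = periodic′ ; injective = Bijection.injective
    (AffinePermutation.bijection x) }
    where
    periodic⁺ : ∀ m z → to x (z + + m * period) ≡ to x z + + m * period
    periodic⁺ zero z = trans (cong (to x) (ℤ.+-identityʳ z)) (sym (ℤ.+-identityʳ (to x z)))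
    periodic⁺ (suc m) z = trans (cong (to x) (lem z (+ m) period))
      (trans (AffinePermutation.periodic x _) (trans (cong (_+ period) (periodic⁺ m z))
      (sym (lem (to x z) (+ m) period))))
      where
      lem : ∀ z m n → z + (1ℤ + m) * n ≡ z + m * n + n
      lem = solve-∀
    periodic′ : ∀ c z → to x (z + c * period) ≡ to x z + c * period
    periodic′ (+ m) z = periodic⁺ m z
    periodic′ ℤ.-[1+ m ] z = trans (lem (to x y) (+ suc m) period)
      (cong (_+ ℤ.-[1+ m ] * period) (trans (sym (periodic⁺ (suc m) y))
      (cong (to x) (lem′ z (+ suc m) period))))
      where
      y = z + ℤ.-[1+ m ] * period
      lem : ∀ x m n → x ≡ x + m * n + (ℤ.- m) * n
      lem = solve-∀
      lem′ : ∀ x m n → x + (ℤ.- m) * n + m * n ≡ x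
      lem′ = solve-∀

  permutation-total : (x : AffinePermutation k) → total (to x) ≡ 0ℤ
  permutation-total x = trans (sum-minus (λ i → to x (+ suc (toℕ i))) (λ i → + suc (toℕ {suc k} i)))
    (ℤ.i≡j⇒i-j≡0 (trans (AffinePermutation.normalised x)
      (sym (trans (sym (ℤ.+-identityʳ _)) (trans (sum-range (suc k) 1)
      (cong (λ l → + (l C 2)) (ℕ.+-comm 2 k)))))))

  -- The relations of the monoid hold in the partial action

  module _ (1≤k : 1 ≤ k) where

    -- Depends on `1 ≤ k`: for `k = 0` the indices `i` and `next i` coincide, and `s i` is the
    -- translation by one instead of an involution.
    s-down : ∀ {i} z → residue z ≡ i → s {k} i (z + 1ℤ) ≡ z
    s-down {i} z p = trans (cong (λ b → if b then y + 1ℤ else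
      (if does (residue y ≟ next i) then y - 1ℤ else y)) (dec-false (residue y ≟ i) y≢i))
       (trans (cong (λ b → if b then y - 1ℤ else y) (dec-true (residue y ≟ next i) y≡)) (lem z))
      where
      y = z + 1ℤ
      y≡ : residue y ≡ next i
      y≡ = trans (residue-suc z) (cong next p)
      y≢i : residue y ≢ i
      y≢i q = next-≢ 1≤k i (trans (sym y≡) q)
      lem : ∀ z → z + 1ℤ - 1ℤ ≡ z
      lem = solve-∀

    -- In `down` the lower point `y` of the swapped pair is an argument, so that matching can
    -- replace `z` by `y + 1ℤ`.
    data Action (i : Fin (suc k)) (z : ℤ) : Set where
      up   : residue z ≡ i → s i z ≡ z + 1ℤ → Action i z
      down : ∀ y → residue y ≡ i → z ≡ y + 1ℤ → s i z ≡ y → Action i z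
      fix  : residue z ≢ i → residue z ≢ next i → s i z ≡ z → Action i z

    residue-pred : ∀ {i : Fin (suc k)} z → residue z ≡ next i → residue (z - 1ℤ) ≡ i
    residue-pred z p = next-injective (trans (sym (residue-suc (z - 1ℤ)))
      (trans (cong residue (sym (pred+1 z))) p))

    action : ∀ i z → Action i z
    action i z with residue z ≟ i
    ... | yes p = up p (s-up z p)
    ... | no ¬p with residue z ≟ next i
    ...   | yes q = down (z - 1ℤ) r (pred+1 z) (trans (cong (s i) (pred+1 z)) (s-down (z - 1ℤ) r))
      where r = residue-pred z q
    ...   | no ¬q = fix ¬p ¬q (s-fix z ¬p ¬q)

    -- Applying a letter turns the ascents at residue `i` into descents, which blocks the same
    -- letter.
    nil-⇒ : ∀ i {f g} → ¬ (f ⟨ a i · a i ⟩⇒ g)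
    nil-⇒ i {f} (h , (asc , h≗) , asc′ , _) = ℤ.<-asym (asc z r)
      (subst₂ ℤ._<_ (trans (h≗ z) (cong f (s-up z r)))
        (trans (h≗ (z + 1ℤ)) (cong f (s-down z r))) (asc′ z r))
      where
      z = + toℕ i
      r = residue-toℕ i

    module Commute {i j : Fin (suc k)} (j≢i : j ≢ i) (j≢i+1 : j ≢ next i) (i≢j+1 : i ≢ next j) where

      fix₀ : ∀ z → residue z ≡ j → s i z ≡ z
      fix₀ z r = s-fix z (λ p → j≢i (trans (sym r) p)) (λ p → j≢i+1 (trans (sym r) p))

      fix₁ : ∀ z → residue z ≡ j → s i (z + 1ℤ) ≡ z + 1ℤ
      fix₁ z r = s-fix (z + 1ℤ) (λ p → i≢j+1 (trans (sym p) r′))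
        (λ p → j≢i (next-injective (trans (sym r′) p)))
        where r′ = trans (residue-suc z) (cong next r)

      fix-moved : ∀ z → s j z ≢ z → s i z ≡ z × s i (s j z) ≡ s j z
      fix-moved z moved with action j z
      ... | up r eq = fix₀ z r , trans (cong (s i) eq) (trans (fix₁ z r) (sym eq))
      ... | down y r refl eq = fix₁ y r , trans (cong (s i) eq) (trans (fix₀ y r) (sym eq))
      ... | fix _ _ eq = contradiction eq moved

    -- The two maps move disjoint sets of points, so at each `z` at most one of them acts; deciding
    -- which avoids comparing all pairs of `Action` cases.
    s-commute : ∀ {i j : Fin (suc k)} → j ≢ i → j ≢ next i → i ≢ next j → s i ∘ s j ≗ s j ∘ s i
    s-commute {i} {j} p q r z with s j z ℤ.≟ z | s i z ℤ.≟ z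
    ... | no m  | _     = trans (proj₂ c) (cong (s j) (sym (proj₁ c)))
      where c = Commute.fix-moved p q r z m
    ... | yes e | no m  = trans (cong (s i) e) (sym (proj₂ (Commute.fix-moved (p ∘ sym) r q z m)))
    ... | yes e | yes e′ = trans (trans (cong (s i) e) e′) (sym (trans (cong (s j) e′) e))

    commute-⇒ : ∀ {i j : Fin (suc k)} → j ≢ i → j ≢ next i → i ≢ next j → ∀ {f g} →
                f ⟨ a i · a j ⟩⇒ g → f ⟨ a j · a i ⟩⇒ g
    commute-⇒ {i} {j} p q r {f} {g} (h , (asc , h≗) , asc′ , g≗) = f ∘ s j ,
      ((λ z e → subst₂ ℤ._<_ (trans (h≗ z) (cong f (I.fix₀ z e)))
        (trans (h≗ (z + 1ℤ)) (cong f (I.fix₁ z e))) (asc′ z e)) , λ _ → refl) ,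
      (λ z e → subst₂ ℤ._<_ (cong f (sym (J.fix₀ z e))) (cong f (sym (J.fix₁ z e))) (asc z e)) ,
      (λ z → trans (g≗ z) (trans (h≗ (s j z)) (cong f (s-commute p q r z))))
      where
      module I = Commute {i} {j} p q r
      module J = Commute {j} {i} (p ∘ sym) r q

    module Braid (2≤k : 2 ≤ k) (i : Fin (suc k)) where

      j = next i

      chain : ∀ (u v w : Fin (suc k)) x {y y′} → s u x ≡ y → s v y ≡ y′ → s w (s v (s u x)) ≡ s w y′
      chain u v w x p q = cong (s w) (trans (cong (s v) p) q)

      module _ (z : ℤ) (r : residue z ≡ i) where
        r₁ : residue (z + 1ℤ) ≡ j
        r₁ = trans (residue-suc z) (cong next r)
        r₂ : residue (z + 1ℤ + 1ℤ) ≡ next j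
        r₂ = trans (residue-suc (z + 1ℤ)) (cong next r₁)
        i₀ : s i z ≡ z + 1ℤ
        i₀ = s-up z r
        i₁ : s i (z + 1ℤ) ≡ z
        i₁ = s-down z r
        i₂ : s i (z + 1ℤ + 1ℤ) ≡ z + 1ℤ + 1ℤ
        i₂ = s-fix (z + 1ℤ + 1ℤ) (λ p → next-next-≢ 2≤k i (trans (sym r₂) p))
          (λ p → next-≢ 1≤k j (trans (sym r₂) p))
        j₀ : s j z ≡ z
        j₀ = s-fix z (λ p → next-≢ 1≤k i (trans (sym p) r))
          (λ p → next-next-≢ 2≤k i (trans (sym p) r))
        j₁ : s j (z + 1ℤ) ≡ z + 1ℤ + 1ℤ
        j₁ = s-up (z + 1ℤ) r₁
        j₂ : s j (z + 1ℤ + 1ℤ) ≡ z + 1ℤ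
        j₂ = s-down (z + 1ℤ) r₁

        braid₀ : s i (s j (s i z)) ≡ s j (s i (s j z))
        braid₀ = trans (trans (chain i j i z i₀ j₁) i₂) (sym (trans (chain j i j z j₀ i₀) j₁))
        braid₁ : s i (s j (s i (z + 1ℤ))) ≡ s j (s i (s j (z + 1ℤ)))
        braid₁ = trans (trans (chain i j i (z + 1ℤ) i₁ j₀) i₀)
          (sym (trans (chain j i j (z + 1ℤ) j₁ i₂) j₂))
        braid₂ : s i (s j (s i (z + 1ℤ + 1ℤ))) ≡ s j (s i (s j (z + 1ℤ + 1ℤ)))
        braid₂ = trans (trans (chain i j i (z + 1ℤ + 1ℤ) i₂ j₂) i₁)
          (sym (trans (chain j i j (z + 1ℤ + 1ℤ) j₂ i₁) j₀))

      -- Both sides reverse every block `z`, `z + 1`, `z + 2` that starts at residue `i` and fix all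
      -- other points.
      s-braid : ∀ z → s i (s j (s i z)) ≡ s j (s i (s j z))
      s-braid z with action i z | action j z
      ... | up r _ | _ = braid₀ z r
      ... | down y r refl _ | _ = braid₁ y r
      ... | fix _ p _ | up r _ = contradiction r p
      -- Here the point is the last of its block, which starts at `y - 1ℤ`.
      ... | fix _ _ _ | down y r refl _ = subst (λ y → s i (s j (s i (y + 1ℤ))) ≡ s j
          (s i (s j (y + 1ℤ))))
              (sym (pred+1 y)) (braid₂ (y - 1ℤ) (residue-pred y r))
      ... | fix _ _ e | fix _ _ e′ = trans (trans (chain i j i z e e′) e)
          (sym (trans (chain j i j z e′ e) e′))

      -- The common domain of the two sides of the braid relation: their three letters test the same
      -- three comparisons, in opposite orders.
      Increasing₃ : (ℤ → ℤ) → Set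
      Increasing₃ f = ∀ z → residue z ≡ i →
        f z ℤ.< f (z + 1ℤ) × f z ℤ.< f (z + 1ℤ + 1ℤ) × f (z + 1ℤ) ℤ.< f (z + 1ℤ + 1ℤ)

      ascent-next : ∀ {f} → (∀ z → residue z ≡ i → f (z + 1ℤ) ℤ.< f (z + 1ℤ + 1ℤ)) → Ascent f j
      ascent-next {f} asc z r = subst (λ z → f z ℤ.< f (z + 1ℤ)) (sym (pred+1 z))
        (asc (z - 1ℤ) (residue-pred z r))

      left⁻ : ∀ {f g} → f ⟨ a i · a j · a i ⟩⇒ g → Increasing₃ f × g ≗ f ∘ s i ∘ s j ∘ s i
      left⁻ {f} (h₂ , (h₁ , (asc₁ , h₁≗) , asc₂ , h₂≗) , asc₃ , g≗) =
        (λ z r → asc₁ z r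
          , subst₂ ℤ._<_ (trans (h₁≗ _) (cong f (i₁ z r))) (trans (h₁≗ _) (cong f (i₂ z r)))
            (asc₂ (z + 1ℤ) (r₁ z r))
          , subst₂ ℤ._<_ (trans (h₂≗ _) (trans (cong h₁ (j₀ z r))
            (trans (h₁≗ _) (cong f (i₀ z r)))))
                         (trans (h₂≗ _) (trans (cong h₁ (j₁ z r))
                           (trans (h₁≗ _) (cong f (i₂ z r))))) (asc₃ z r)) ,
        λ z → trans (g≗ z) (trans (h₂≗ _) (h₁≗ _))

      right⁻ : ∀ {f g} → f ⟨ a j · a i · a j ⟩⇒ g → Increasing₃ f × g ≗ f ∘ s j ∘ s i ∘ s j
      right⁻ {f} (h₂ , (h₁ , (asc₁ , h₁≗) , asc₂ , h₂≗) , asc₃ , g≗) =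
        (λ z r → subst₂ ℤ._<_ (trans (h₂≗ _) (trans (cong h₁ (i₁ z r))
          (trans (h₁≗ _) (cong f (j₀ z r)))))
                         (trans (h₂≗ _) (trans (cong h₁ (i₂ z r))
                           (trans (h₁≗ _) (cong f (j₂ z r))))) (asc₃ (z + 1ℤ) (r₁ z r))
          , subst₂ ℤ._<_ (trans (h₁≗ _) (cong f (j₀ z r))) (trans (h₁≗ _) (cong f (j₁ z r)))
            (asc₂ z r)
          , asc₁ (z + 1ℤ) (r₁ z r)) ,
        λ z → trans (g≗ z) (trans (h₂≗ _) (h₁≗ _))

      left⁺ : ∀ {f g} → Increasing₃ f → g ≗ f ∘ s i ∘ s j ∘ s i → f ⟨ a i · a j · a i ⟩⇒ g
      left⁺ {f} inc g≗ = f ∘ s i ∘ s j , (f ∘ s i ,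
        ((λ z r → proj₁ (inc z r)) , λ _ → refl) ,
        ascent-next (λ z r → subst₂ ℤ._<_ (cong f (sym (i₁ z r))) (cong f (sym (i₂ z r)))
          (proj₁ (proj₂ (inc z r)))) , λ _ → refl) ,
        (λ z r → subst₂ ℤ._<_ (cong f (sym (trans (cong (s i) (j₀ z r)) (i₀ z r))))
          (cong f (sym (trans (cong (s i) (j₁ z r)) (i₂ z r)))) (proj₂ (proj₂ (inc z r)))) ,
        g≗

      right⁺ : ∀ {f g} → Increasing₃ f → g ≗ f ∘ s j ∘ s i ∘ s j → f ⟨ a j · a i · a j ⟩⇒ g
      right⁺ {f} inc g≗ = f ∘ s j ∘ s i , (f ∘ s j ,
        (ascent-next (λ z r → proj₂ (proj₂ (inc z r))) , λ _ → refl) ,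
        (λ z r → subst₂ ℤ._<_ (cong f (sym (j₀ z r))) (cong f (sym (j₁ z r)))
          (proj₁ (proj₂ (inc z r)))) , λ _ → refl) ,
        ascent-next (λ z r → subst₂ ℤ._<_ (cong f (sym (trans (cong (s j) (i₁ z r)) (j₀ z r))))
          (cong f (sym (trans (cong (s j) (i₂ z r)) (j₂ z r)))) (proj₁ (inc z r))) ,
        g≗

    -- Makes the action a model of the monoid; in particular an expression equal to `𝟘` acts
    -- nowhere. It is stated as an equivalence so that the induction passes through `≈-sym`.
    sound : ∀ {x y : NilCoxeter k} → x ≈ y → ∀ {f g} → f ⟨ x ⟩⇒ g ⇔ f ⟨ y ⟩⇒ g
    sound ≈-refl = mk⇔ id id
    sound (≈-sym e) = mk⇔ (Equivalence.from (sound e)) (Equivalence.to (sound e))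
    sound (≈-trans e e′) = mk⇔ (Equivalence.to (sound e′) ∘ Equivalence.to (sound e))
      (Equivalence.from (sound e) ∘ Equivalence.from (sound e′))
    sound (·-cong e e′) = mk⇔
      (λ { (h , p , q) → h , Equivalence.to (sound e) p , Equivalence.to (sound e′) q })
      (λ { (h , p , q) → h , Equivalence.from (sound e) p , Equivalence.from (sound e′) q })
    sound (·-assoc x y z) = mk⇔
      (λ { (h , (h′ , p , q) , r) → h′ , p , h , q , r })
      (λ { (h , p , h′ , q , r) → h′ , (h , p , q) , r })
    sound (identityˡ x) = mk⇔ (λ { (h , e , p) → ⇒-resp x e (λ _ → refl) p })
      (λ p → _ , (λ _ → refl) , p)
    sound (identityʳ x) = mk⇔ (λ { (h , p , e) → ⇒-resp x (λ _ → refl) (λ z → sym (e z)) p })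
      (λ p → _ , p , λ _ → refl)
    sound (zeroˡ x) = mk⇔ (λ { (_ , () , _) }) λ ()
    sound (zeroʳ x) = mk⇔ (λ { (_ , _ , ()) }) λ ()
    sound (nil i) {f} {g} = mk⇔ (nil-⇒ i {f} {g}) λ ()
    sound (commute i j p q r) = mk⇔ (commute-⇒ p q r) (commute-⇒ (p ∘ sym) r q)
    sound (braid 2≤k i) {f} = mk⇔
      (λ p → let inc , e = left⁻ p in right⁺ inc (λ z → trans (e z) (cong f (s-braid z))))
      (λ p → let inc , e = right⁻ p in left⁺ inc (λ z → trans (e z) (cong f (sym (s-braid z)))))
      where open Braid 2≤k i

    -- Affinity and conjugation of generators

    s-involutive : ∀ i z → s {k} i (s i z) ≡ z
    s-involutive i z with action i z
    ... | up r eq          = trans (cong (s i) eq) (s-down z r)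
    ... | down y r refl eq = trans (cong (s i) eq) (s-up y r)
    ... | fix _ _ eq       = trans (cong (s i) eq) eq

    s-affine : ∀ i → Affine (s i)
    s-affine i = record
      { periodic  = λ c z → shift c z (action i z)
      ; injective = λ {y} {z} eq → trans (sym (s-involutive i y))
        (trans (cong (s i) eq) (s-involutive i z))
      }
      where
      shift : ∀ c z → Action i z → s {k} i (z + c * period) ≡ s i z + c * period
      shift c z (up r eq) = trans (s-up (z + c * period) (trans (residue-shift c z) r))
        (trans (+-swapʳ z (c * period) 1ℤ) (cong (_+ c * period) (sym eq)))
      shift c _ (down y r refl eq) = trans (cong (s i) (+-swapʳ y 1ℤ (c * period)))
        (trans (s-down (y + c * period) (trans (residue-shift c y) r))
          (cong (_+ c * period) (sym eq)))
      shift c z (fix p q eq) = trans (s-fix (z + c * period)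
        (p ∘ trans (sym (residue-shift c z))) (q ∘ trans (sym (residue-shift c z))))
        (cong (_+ c * period) (sym eq))

    id-affine : Affine id
    id-affine = record { periodic = λ _ _ → refl ; injective = id }

    ∘-affine : ∀ {f g} → Affine f → Affine g → Affine (f ∘ g)
    ∘-affine {f} {g} F G = record
      { periodic  = λ c z → trans (cong f (periodic G c z)) (periodic F c (g z))
      ; injective = injective G ∘ injective F
      }

    sWord-affine : ∀ w → Affine (sWord w)
    sWord-affine []      = id-affine
    sWord-affine (i ∷ w) = ∘-affine (s-affine i) (sWord-affine w)

    -- Every point moves by at most one. Hence two points can change order only if the left one goes
    -- up and the right one goes down, and then they form a swapped pair.
    s-reverses : ∀ {j : Fin (suc k)} {p q} → p ℤ.< q → s j q ℤ.< s j p → residue p ≡ j × q ≡ p + 1ℤ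
    s-reverses {j} {p} {q} p<q sq<sp = cases (action j p) (action j q)
      where
      moved : ∀ {u v} → s j p ≡ u → s j q ≡ v → v ℤ.< u
      moved e e′ = subst₂ ℤ._<_ e′ e sq<sp

      shift : ∀ x y → (x + 1ℤ) - (y + 1ℤ) ≡ x - y
      shift = solve-∀

      cases : Action j p → Action j q → residue p ≡ j × q ≡ p + 1ℤ
      cases (up r e) (up _ e′) = contradiction (<-by (moved e e′) (shift p q)) (ℤ.<-asym p<q)
      cases (up r e) (down y _ q≡ e′) = r , trans q≡
        (cong (_+ 1ℤ) (ℤ.≤-antisym (<+1⇒≤ (moved e e′)) (<+1⇒≤ (subst (p ℤ.<_) q≡ p<q))))
      cases (up r e) (fix _ _ e′) = contradiction p<q (ℤ.≤⇒≯ (<+1⇒≤ (moved e e′)))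
      cases (down y _ p≡ e) (up _ e′) = contradiction p<q (ℤ.<-asym
        (ℤ.<-trans (i<i+1 q) (ℤ.<-trans (moved e e′) (subst (y ℤ.<_) (sym p≡) (i<i+1 y)))))
      cases (down y _ p≡ e) (down w _ q≡ e′) = contradiction (moved e e′)
        (ℤ.<-asym (<-by (subst₂ ℤ._<_ p≡ q≡ p<q) (shift w y)))
      cases (down y _ p≡ e) (fix _ _ e′) = contradiction p<q (ℤ.<-asym
        (ℤ.<-trans (moved e e′) (subst (y ℤ.<_) (sym p≡) (i<i+1 y))))
      cases (fix _ _ e) (up _ e′) = contradiction (ℤ.<-trans (i<i+1 q) (moved e e′)) (ℤ.<-asym p<q)
      cases (fix _ _ e) (down w _ q≡ e′) = contradiction (moved e e′)
        (ℤ.≤⇒≯ (<+1⇒≤ (subst (p ℤ.<_) q≡ p<q)))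
      cases (fix _ _ e) (fix _ _ e′) = contradiction (moved e e′) (ℤ.<-asym p<q)

    -- f conjugates s i into s j because it maps the pair z, z + 1 to the pair f z, f z + 1.
    conjugate : ∀ {f i j z} → Affine f → residue z ≡ i → residue (f z) ≡ j → f (z + 1ℤ) ≡ f z + 1ℤ →
                f ≗ s j ∘ f ∘ s i
    conjugate {f} {i} {j} {z} F r r′ eq y = sym (value (action i y))
      where
      at : ∀ c → f (z + c * period) ≡ f z + c * period
      at c = periodic F c z

      at₁ : ∀ c → f (z + c * period + 1ℤ) ≡ f z + c * period + 1ℤ
      at₁ c = trans (cong f (+-swapʳ z (c * period) 1ℤ)) (trans (periodic F c (z + 1ℤ))
        (trans (cong (_+ c * period) eq) (+-swapʳ (f z) 1ℤ (c * period))))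

      rc : ∀ c → residue (f z + c * period) ≡ j
      rc c = trans (residue-shift c (f z)) r′

      value : Action i y → s j (f (s i y)) ≡ f y
      value (up ry e) with residue-congruent {z} {y} (trans r (sym ry))
      ... | c , refl = trans (cong (s j) (trans (cong f e) (at₁ c)))
          (trans (s-down (f z + c * period) (rc c)) (sym (at c)))
      value (down y′ ry refl e) with residue-congruent {z} {y′} (trans r (sym ry))
      ... | c , refl = trans (cong (s j) (trans (cong f e) (at c)))
          (trans (s-up (f z + c * period) (rc c)) (sym (at₁ c)))
      value (fix p q e) = trans (cong (s j ∘ f) e) (fixed (action j (f y)))
        where
        fixed : Action j (f y) → s j (f y) ≡ f y
        fixed (fix _ _ e) = e
        fixed (up ry _) with residue-congruent {f z} {f y} (trans r′ (sym ry))
        ... | c , fy≡ = contradiction (trans (cong residue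
            (injective F (trans fy≡ (sym (at c))))) (trans (residue-shift c z) r)) p
        fixed (down u ru fy≡u+1 _) with residue-congruent {f z} {u} (trans r′ (sym ru))
        ... | c , u≡ = contradiction (trans (cong residue
            (injective F (trans fy≡u+1 (trans (cong (_+ 1ℤ) u≡) (sym (at₁ c))))))
                (trans (residue-suc (z + c * period)) (cong next (trans (residue-shift c z) r)))) q

    -- The exchange condition and reduced words

    -- Strip letters from the left until the two values are in order. The last letter stripped
    -- reverses them, so by `s-reverses` and `conjugate` it is the one that `s i` cancels.
    exchange : ∀ w (i : Fin (suc k)) z → residue z ≡ i → sWord w (z + 1ℤ) ℤ.< sWord w z →
               ∃ λ v → sWord {k} v ≗ sWord w ∘ s i × suc (length v) ≡ length w
    exchange [] i z r lt = contradiction lt (ℤ.<-asym (i<i+1 z))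
    exchange (j ∷ w) i z r lt with ℤ.<-cmp (sWord w z) (sWord w (z + 1ℤ))
    ... | tri< p<q _ _ =
        let r′ , eq = s-reverses p<q lt in w , conjugate (sWord-affine w) r r′ eq , refl
    ... | tri≈ _ p≡q _ = contradiction (i<i+1 z) (ℤ.<-irrefl (injective (sWord-affine w) p≡q))
    ... | tri> _ _ q<p =
        let v , eq , len = exchange w i z r q<p in j ∷ v , (λ y → cong (s j) (eq y)) , cong suc len

    -- An ascent of `sWord u` becomes a descent of `sWord v`, so `exchange` deletes a letter of `v`.
    -- A rival of `u ++ [ i ]` thus yields a rival of `u` that is one letter shorter.
    shorten : ∀ u v (i : Fin (suc k)) z → residue z ≡ i → Ascent (sWord u) i → sWord v ≗ sWord
      {k} u ∘ s i →
              ∃ λ w → sWord w ≗ sWord u × suc (length w) ≡ length v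
    shorten u v i z r asc v≗ =
      let w , w≗ , len = exchange v i z r (subst₂ ℤ._<_ (sym at₁) (sym at₀) (asc z r))
      in w , (λ y → trans (w≗ y) (trans (v≗ (s i y)) (cong (sWord u) (s-involutive i y)))) , len
      where
      at₀ : sWord v z ≡ sWord u (z + 1ℤ)
      at₀ = trans (v≗ z) (cong (sWord u) (s-up z r))
      at₁ : sWord v (z + 1ℤ) ≡ sWord u z
      at₁ = trans (v≗ (z + 1ℤ)) (cong (sWord u) (s-down z r))

    reduced-∷ʳ : ∀ u {i} → Reduced {k} u → Ascent (sWord u) i → Reduced (u ++ [ i ])
    reduced-∷ʳ u {i} red asc v v≗ =
      let z = + toℕ i
          w , w≗ , len = shorten u v i z (residue-toℕ i) asc
            (λ y → trans (v≗ y) (sWord-++ u [ i ] y))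
      in subst₂ _≤_ (sym (trans (length-++ u) (ℕ.+-comm (length u) 1))) len (s≤s (red w w≗))

    -- At a descent, `exchange` would replace `u ++ [ i ]` by a word two letters shorter.
    reduced-ascent : ∀ u {i} w → Reduced {k} (u ++ i ∷ w) → Ascent (sWord u) i
    reduced-ascent u {i} w red z r = ℤ.≤∧≢⇒<
      (ℤ.≮⇒≥ λ gt → let v , v≗ , len = exchange u i z r gt in
        contradiction (red (v ++ w) (same v v≗)) (ℕ.<⇒≱ (shorter v len)))
      (λ eq → ℤ.<-irrefl (injective (sWord-affine u) eq) (i<i+1 z))
      where
      same : ∀ v → sWord v ≗ sWord u ∘ s i → sWord (v ++ w) ≗ sWord (u ++ i ∷ w)
      same v v≗ y = trans (sWord-++ v w y) (trans (v≗ (sWord w y)) (sym (sWord-++ u (i ∷ w) y)))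
      shorter : ∀ v → suc (length v) ≡ length u → length (v ++ w) < length (u ++ i ∷ w)
      shorter v len = subst₂ _<_ (sym (length-++ v)) (sym (length-++ u))
        (ℕ.+-mono-≤ (ℕ.≤-reflexive len) (ℕ.n≤1+n (length w)))

    ⇒-word : ∀ w {f g} → f ⟨ aWord {k} w ⟩⇒ g → g ≗ f ∘ sWord w
    ⇒-word [] eq = eq
    ⇒-word (i ∷ w) (h , (_ , h≗) , p) z = trans (⇒-word w p z) (h≗ (sWord w z))

    -- Reducedness concerns the whole word, but the action proceeds letter by letter; `u`
    -- accumulates the letters already applied.
    reduced⇒ : ∀ u w → Reduced {k} (u ++ w) → sWord u ⟨ aWord w ⟩⇒ sWord u ∘ sWord w
    reduced⇒ u []      red = λ _ → refl
    reduced⇒ u (i ∷ w) red = _ , (reduced-ascent u w red , λ _ → refl) ,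
      ⇒-resp (aWord w) (sWord-++ u [ i ]) (λ z → sWord-++ u [ i ] (sWord w z))
        (reduced⇒ (u ++ [ i ]) w (subst Reduced (sym (++-assoc u [ i ] w)) red))

    ⇒reduced : ∀ u w {g} → Reduced {k} u → sWord u ⟨ aWord w ⟩⇒ g → Reduced (u ++ w)
    ⇒reduced u []      red _ = subst Reduced (sym (++-identityʳ u)) red
    ⇒reduced u (i ∷ w) red (h , (asc , h≗) , p) = subst Reduced (++-assoc u [ i ] w)
      (⇒reduced (u ++ [ i ]) w (reduced-∷ʳ u red asc)
        (⇒-resp (aWord w) (λ z → trans (h≗ z) (sym (sWord-++ u [ i ] z))) (λ _ → refl) p))

    -- Cyclically decreasing right factors

    -- Undoing the letters of d A from the right sweeps through the positions g, g + 1,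
    -- …, g + k + 1.  After m of them the function h agrees with f beyond g + m, and the
    -- letter g + m, if present, moves the value of h at g + m one step to the right.
    module Scan (A : Subset (suc k)) (g : Fin (suc k)) (g∉A : g ∉ A) where

      prefix : ℕ → Word k
      prefix m = filter (_∈? A) (applyDownFrom (rotate g) m)

      prefix-∈ : ∀ m → rotate g m ∈ A → prefix (suc m) ≡ rotate g m ∷ prefix m
      prefix-∈ m = filter-accept (_∈? A)

      prefix-∉ : ∀ m → rotate g m ∉ A → prefix (suc m) ≡ prefix m
      prefix-∉ m = filter-reject (_∈? A)

      pos : ℕ → ℤ
      pos t = + (toℕ g ℕ.+ t)

      pos-+ : ∀ m t → pos (m ℕ.+ t) ≡ pos m + + t
      pos-+ m t = cong +_ (sym (ℕ.+-assoc (toℕ g) m t))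

      pos-suc : ∀ m → pos (suc m) ≡ pos m + 1ℤ
      pos-suc m = trans (cong pos (ℕ.+-comm 1 m)) (pos-+ m 1)

      rotate₀ : rotate g 0 ∉ A
      rotate₀ = subst (_∉ A) (sym (trans (cong residue (cong +_ (ℕ.+-identityʳ (toℕ g))))
        (residue-toℕ g))) g∉A

      distinct : ∀ m t → m < t → t ℕ.≤ m ℕ.+ k → residue (pos t) ≢ rotate g m
      distinct m t m<t t≤ eq with ℕ.m≤n⇒∃[o]m+o≡n m<t
      ... | o , refl = residue-+-≢ (pos m) o (ℕ.+-cancelˡ-≤ m (suc o) k
          (subst (_≤ m ℕ.+ k) (sym (ℕ.+-suc m o)) t≤))
         (trans (cong residue (trans (sym (pos-+ m (suc o))) (cong pos (ℕ.+-suc m o)))) eq)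

      s-pos : ∀ m t → suc m < t → t ≤ suc k → rotate g m ∈ A → s (rotate g m) (pos t) ≡ pos t
      -- The last position `pos (suc k)` has residue `g` again, so the letter `g` would move it;
      -- this is why the scan has to start at a gap.
      s-pos zero    t m<t t≤ i∈A = contradiction i∈A rotate₀
      s-pos (suc m) t m<t t≤ i∈A = s-fix (pos t)
        (distinct (suc m) t (ℕ.<⇒≤ m<t) (ℕ.≤-trans t≤ (s≤s (ℕ.m≤n+m k m))))
        (λ p → distinct (suc (suc m)) t m<t (ℕ.≤-trans t≤ (s≤s (ℕ.m≤n+m k (suc m))))
          (trans p (next-rotate g (suc m))))

      s-pos₀ : ∀ m → s (rotate g m) (pos m) ≡ pos (suc m)
      s-pos₀ m = trans (s-up (pos m) refl) (sym (pos-suc m))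

      s-pos₁ : ∀ m → s (rotate g m) (pos (suc m)) ≡ pos m
      s-pos₁ m = trans (cong (s (rotate g m)) (pos-suc m)) (s-down (pos m) refl)

      -- The range ends at `suc k` because further positions are periodic copies of those already
      -- swept.
      Untouched : (h f : ℤ → ℤ) → ℕ → Set
      Untouched h f m = ∀ t → m < t → t ≤ suc k → h (pos t) ≡ f (pos t)

      untouched-weaken : ∀ {h f m} → Untouched h f m → Untouched h f (suc m)
      untouched-weaken same t m<t = same t (ℕ.<⇒≤ m<t)

      module _ {f} (F : Affine f) where

        cover : ∀ m t → t ≤ m → m ≤ k → f (pos (suc m)) ℤ.< f (pos t) → rotate g m ∈ coveredSet f
        cover m t t≤m m≤k lt = ∈covered⁺ F {pos m} (fromℕ< m∸t<n ,
          subst₂ (λ u v → f u ℤ.< f v) (pos-suc m)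
            (trans (sym (trans (ℤ.m-n≡m⊖n (toℕ g ℕ.+ m) (m ∸ t))
              (trans (ℤ.⊖-≥ (ℕ.≤-trans (ℕ.m∸n≤m m t) (ℕ.m≤n+m m (toℕ g)))) (cong +_ diff))))
              (cong (λ u → pos m - + u) (sym (toℕ-fromℕ< m∸t<n)))) lt)
          where
          m∸t<n : m ∸ t < suc k
          m∸t<n = s≤s (ℕ.≤-trans (ℕ.m∸n≤m m t) m≤k)
          diff : toℕ g ℕ.+ m ∸ (m ∸ t) ≡ toℕ g ℕ.+ t
          diff = trans (ℕ.+-∸-assoc (toℕ g) (ℕ.m∸n≤m m t)) (cong (toℕ g ℕ.+_) (ℕ.m∸[m∸n]≡n t≤m))

        -- The value carried along is always some value of f further left.
        scan⁻ : ∀ m → m ≤ suc k → ∀ {h} → h ⟨ aWord (prefix m) ⟩⇒ f →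
                Untouched h f m × (∃ λ t → t ≤ m × h (pos m) ≡ f (pos t)) ×
                (∀ t → t < m → rotate g t ∈ A → rotate g t ∈ coveredSet f)
        scan⁻ zero m≤ eq = (λ t _ _ → sym (eq (pos t))) , (0 , z≤n , sym (eq (pos 0))) , λ _ ()
        scan⁻ (suc m) m<n {h} p with rotate g m ∈? A
        -- With the letter absent, the carried value is dropped and the one at `pos (suc m)` is
        -- taken up.
        ... | no i∉A =
          let same , (t , t≤m , _) , sub = scan⁻ m (ℕ.<⇒≤ m<n) p in
          untouched-weaken {h} {f} same , (suc m , ℕ.≤-refl , same (suc m) ℕ.≤-refl m<n) ,
          λ t t≤m t∈A → sub t (ℕ.≤∧≢⇒< (ℕ.≤-pred t≤m) (λ { refl → i∉A t∈A })) t∈A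
        scan⁻ (suc m) m<n {h} (h′ , (asc , h′≗) , p) | yes i∈A =
          (λ t m<t t≤ → trans (cong h (sym (s-pos m t m<t t≤ i∈A)))
            (trans (sym (h′≗ (pos t))) (same t (ℕ.<⇒≤ m<t) t≤))) ,
          (t₀ , ℕ.m≤n⇒m≤1+n t₀≤m , val) ,
          λ t t≤m t∈A → extend t (ℕ.m≤n⇒m<n∨m≡n (ℕ.≤-pred t≤m)) t∈A
          where
          ih = scan⁻ m (ℕ.<⇒≤ m<n) p
          same = proj₁ ih
          t₀ = proj₁ (proj₁ (proj₂ ih))
          t₀≤m = proj₁ (proj₂ (proj₁ (proj₂ ih)))
          val : h (pos (suc m)) ≡ f (pos t₀)
          val = trans (cong h (sym (s-pos₀ m))) (trans (sym (h′≗ (pos m)))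
            (proj₂ (proj₂ (proj₁ (proj₂ ih)))))
          val₁ : h (pos m) ≡ f (pos (suc m))
          val₁ = trans (cong h (sym (s-pos₁ m))) (trans (sym (h′≗ (pos (suc m))))
            (same (suc m) ℕ.≤-refl m<n))
          extend : ∀ t → _ → rotate g t ∈ A → rotate g t ∈ coveredSet f
          extend t (inj₁ t<m) t∈A = proj₂ (proj₂ ih) t t<m t∈A
          -- The ascent that permits the letter says that the value of `f` at `pos (suc m)` is below
          -- the carried one.
          extend t (inj₂ refl) _ = cover m t₀ t₀≤m (ℕ.≤-pred m<n)
            (subst₂ ℤ._<_ val₁ (trans (cong h (sym (pos-suc m))) val) (asc (pos m) refl))

        Record : (ℤ → ℤ) → ℕ → Set
        Record h m = ∀ t → t ≤ k → f (pos m - + t) ℤ.≤ h (pos m)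

        record-suc : ∀ {h} m → f (pos (suc m)) ℤ.≤ h (pos (suc m)) →
                     (∀ t → t ≤ k → f (pos m - + t) ℤ.≤ h (pos (suc m))) → Record h (suc m)
        record-suc {h} m le rec zero    _  = subst (λ z → f z ℤ.≤ h (pos (suc m)))
          (sym (ℤ.+-identityʳ (pos (suc m)))) le
        record-suc {h} m le rec (suc t) t< = subst (λ z → f z ℤ.≤ h (pos (suc m)))
          (trans (lem (pos m) (+ t)) (cong (_- + suc t) (sym (pos-suc m)))) (rec t (ℕ.<⇒≤ t<))
          where
          lem : ∀ p t → p - t ≡ p + 1ℤ - (1ℤ + t)
          lem = solve-∀

        uncovered : ∀ m → rotate g m ∉ coveredSet f → ∀ t → t ≤ k → f (pos m - + t) ℤ.≤ f
          (pos (suc m))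
        uncovered m i∉C t t≤k = ℤ.≮⇒≥ λ lt → i∉C (∈covered⁺ F {pos m} (fromℕ< (s≤s t≤k) ,
          subst₂ (λ u v → f u ℤ.< f (pos m - + v)) (pos-suc m) (sym (toℕ-fromℕ< (s≤s t≤k))) lt))

        -- The value carried along is the running maximum of f.
        scan⁺ : A ≡ coveredSet f → ∀ m → m ≤ k → ∃ λ h →
                Affine h × h ⟨ aWord (prefix (suc m)) ⟩⇒ f × Untouched h f (suc m) × Record h (suc m)
        -- As `g` is not covered, `f` has a left-to-right maximum at `pos 1`; the running maximum
        -- starts there.
        scan⁺ refl zero m≤k = f , F , subst (λ w → f ⟨ aWord w ⟩⇒ f) (sym (prefix-∉ 0 rotate₀))
          (λ _ → refl) , (λ _ _ _ → refl) ,
          record-suc {f} 0 ℤ.≤-refl (uncovered 0 rotate₀)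
        scan⁺ refl (suc m) m<k with scan⁺ refl m (ℕ.<⇒≤ m<k)
        ... | h , H , p , same , rec with rotate g (suc m) ∈? A
        -- At an uncovered index the next value of `f` is itself a left-to-right maximum and takes
        -- over.
        ...   | no i∉A = h , H , p , untouched-weaken {h} {f} same ,
                record-suc {h} (suc m) (ℤ.≤-reflexive (sym eq))
                  (λ t t≤k → subst (f (pos (suc m) - + t) ℤ.≤_) (sym eq)
                  (uncovered (suc m) i∉A t t≤k))
          where eq = same (suc (suc m)) ℕ.≤-refl (s≤s m<k)
        ...   | yes i∈A = h ∘ s i , H′ , (h , (asc , λ z → cong h (sym (s-involutive i z))) , p) ,
                (λ t m<t t≤ → trans (cong h (s-pos (suc m) t m<t t≤ i∈A)) (same t (ℕ.<⇒≤ m<t) t≤)) ,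
                record-suc {h ∘ s i} (suc m) (subst (f (pos (suc (suc m))) ℤ.≤_) (sym val₁)
                  (ℤ.<⇒≤ below)) (λ t t≤k → subst (f (pos (suc m) - + t) ℤ.≤_) (sym val₁)
                  (rec t t≤k))
          where
          i = rotate g (suc m)
          H′ : Affine (h ∘ s i)
          H′ = ∘-affine H (s-affine i)
          val₀ : h (s i (pos (suc m))) ≡ f (pos (suc (suc m)))
          val₀ = trans (cong h (s-pos₀ (suc m))) (same (suc (suc m)) ℕ.≤-refl (s≤s m<k))
          val₁ : h (s i (pos (suc (suc m)))) ≡ h (pos (suc m))
          val₁ = cong h (s-pos₁ (suc m))
          cov : Covered f (pos (suc m))
          cov = ∈covered⁻ F (pos (suc m)) i∈A
          -- The witness of `cov` is one of the `k + 1` values that `rec` bounds by the running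
          -- maximum.
          below : f (pos (suc (suc m))) ℤ.< h (pos (suc m))
          below = ℤ.<-≤-trans
            (subst (λ z → f z ℤ.< f (pos (suc m) - + toℕ (proj₁ cov)))
              (sym (pos-suc (suc m))) (proj₂ cov))
            (rec (toℕ (proj₁ cov)) (ℕ.≤-pred (toℕ<n (proj₁ cov))))
          asc : Ascent (h ∘ s i) i
          asc = ascent {f = h ∘ s i} {pos (suc m)} H′
            (subst₂ ℤ._<_ (sym val₀) (trans (sym val₁) (cong (h ∘ s i) (pos-suc (suc m)))) below)

    factor⊆covered : ∀ {f h} A → Affine f → Proper A → h ⟨ d A ⟩⇒ f → A ⊆ coveredSet f
    factor⊆covered {f} A F A⊂ p {i} i∈A = subst (_∈ coveredSet f) eq
      (proj₂ (proj₂ (Scan.scan⁻ A (gap A) (gap∉ A⊂) F (suc k) ℕ.≤-refl p)) (unrotate (gap A) i)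
        (unrotate< (gap A) i)
        (subst (_∈ A) (sym eq) i∈A))
      where
      eq = rotate-unrotate (gap A) i

    covered-factor : ∀ {f} → Affine f → ∃ λ h → h ⟨ d (coveredSet f) ⟩⇒ f
    covered-factor {f} F =
      let A = coveredSet f
          h , _ , p , _ = Scan.scan⁺ A (gap A) (gap∉ (covered-proper F)) F refl k ℕ.≤-refl
      in h , p

    -- Effect of one letter on total and energy

    module Step {i : Fin (suc k)} {f h : ℤ → ℤ} (H : Affine h) (asc : Ascent h i)
      (f≗ : f ≗ h ∘ s i) where

      F : Affine f
      F = affine-resp (sym ∘ f≗) (∘-affine H (s-affine i))

      -- Because of the offset in `window`, the swapped positions, of residues `i` and `next i`,
      -- belong to the entries `prev i` and `i`.
      r : Fin (suc k)
      r = prev i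

      y : ℤ
      y = + suc (toℕ r)

      residue-y : residue y ≡ i
      residue-y = next-prev i

      r≢i : r ≢ i
      r≢i eq = next-≢ 1≤k i (trans (cong next (sym eq)) (next-prev i))

      residue-y+1 : residue (y + 1ℤ) ≡ next i
      residue-y+1 = trans (residue-suc y) (cong next residue-y)

      -- The value that moves one place to the left gains one in displacement, and its partner loses
      -- one.
      at-r : window f r ≡ window h i + 1ℤ
      at-r = trans (cong (_- y) (trans (f≗ y) (cong h (s-up y residue-y))))
        (trans (lem (h (y + 1ℤ)) y)
        (cong (_+ 1ℤ) (displacement-cong H {y + 1ℤ} {+ suc (toℕ i)} residue-y+1)))
        where
        lem : ∀ x y → x - y ≡ x - (y + 1ℤ) + 1ℤ
        lem = solve-∀

      at-i : window f i ≡ window h r - 1ℤ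
      at-i = trans (sym (displacement-cong F {y + 1ℤ} {+ suc (toℕ i)} residue-y+1))
        (trans (cong (_- (y + 1ℤ)) (trans (f≗ (y + 1ℤ)) (cong h (s-down y residue-y))))
        (lem (h y) y))
        where
        lem : ∀ x y → x - (y + 1ℤ) ≡ x - y - 1ℤ
        lem = solve-∀

      off : ∀ l → l ≢ r → l ≢ i → window f l ≡ window h l
      off l l≢r l≢i = cong (_- (+ suc (toℕ l))) (trans (f≗ _) (cong h (s-fix (+ suc (toℕ l))
        (λ p → l≢r (next-injective (trans p (sym (next-prev i))))) (λ p → l≢i (next-injective p)))))

      a≤b : window h r ℤ.≤ window h i
      a≤b = subst (window h r ℤ.≤_) (displacement-cong H {y + 1ℤ} {+ suc (toℕ i)} residue-y+1)
        (≤-by (<⇒+1≤ (asc y residue-y)) (lem (h y) (h (y + 1ℤ)) y))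
        where
        lem : ∀ x x′ y → x′ - (x + 1ℤ) ≡ (x′ - (y + 1ℤ)) - (x - y)
        lem = solve-∀

      total-≡ : total f ≡ total h
      total-≡ = trans (lem′ (total f) (window f r + window f i))
        (trans (cong₂ _+_ (sum-change₂ r≢i off) (cong₂ _+_ at-r at-i))
          (lem (total h) (window h r) (window h i)))
        where
        lem : ∀ e p q → (e - (p + q)) + ((q + 1ℤ) + (p - 1ℤ)) ≡ e
        lem = solve-∀
        lem′ : ∀ e x → e ≡ e - x + x
        lem′ = solve-∀

      energy-< : energy h + 1ℤ ℤ.≤ energy f
      energy-< = ≤-by {i = 0ℤ} {e = energy f} (ℤ.+-mono-≤
        (ℤ.+-mono-≤ (ℤ.i≤j⇒0≤j-i a≤b) (ℤ.i≤j⇒0≤j-i a≤b)) (ℤ.+≤+ (z≤n {1})))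
          (trans (lem (window h r) (window h i) (energy h)) (cong (_- (energy h + 1ℤ)) (sym eq)))
        where
        p = window h r
        q = window h i
        lem : ∀ p q e → ((q - p) + (q - p) + 1ℤ) - 0ℤ ≡
          (e - (p * p + q * q) + ((q + 1ℤ) * (q + 1ℤ) + (p - 1ℤ) * (p - 1ℤ))) - (e + 1ℤ)
        lem = solve-∀
        lem′ : ∀ e x → e ≡ e - x + x
        lem′ = solve-∀
        eq : energy f ≡ energy h - (p * p + q * q) + ((q + 1ℤ) * (q + 1ℤ) + (p - 1ℤ) * (p - 1ℤ))
        eq = trans (lem′ (energy f) (window f r * window f r + window f i * window f i))
          (cong₂ _+_ (sum-change₂ r≢i (λ l l≢r l≢i → cong (λ x → x * x) (off l l≢r l≢i)))
            (cong₂ (λ x x′ → x * x + x′ * x′) at-r at-i))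

    -- Supplies the invariants for the recursion in `greedy`: the remaining map is again affine with
    -- the same total, and each letter undone costs at least one unit of energy.
    descend : ∀ w {f h} → Affine f → h ⟨ aWord w ⟩⇒ f →
              Affine h × total h ≡ total f × energy h + + length w ℤ.≤ energy f
    descend [] {f} {h} F f≗h = affine-resp f≗h F , sum-cong-≗ (window-cong (sym ∘ f≗h)) ,
      ℤ.≤-reflexive (trans (ℤ.+-identityʳ (energy h))
        (sum-cong-≗ λ i → cong (λ x → x * x) (window-cong (sym ∘ f≗h) i)))
    descend (i ∷ w) {f} {h} F (h′ , (asc , h′≗) , p) = H , trans (sym total-≡) (proj₁ (proj₂ ih)) ,
      ℤ.≤-trans (ℤ.≤-reflexive (sym (ℤ.+-assoc (energy h) 1ℤ (+ length w))))
        (ℤ.≤-trans (ℤ.+-monoˡ-≤ (+ length w) energy-<) (proj₂ (proj₂ ih)))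
      where
      ih = descend w F p
      H : Affine h
      H = affine-resp (λ z → trans (h′≗ (s i z)) (cong h (s-involutive i z)))
        (∘-affine (proj₁ ih) (s-affine i))
      open Step {i} {h′} {h} H asc h′≗

    -- The greedy decomposition

    -- Together with `⇒represents` this replaces the reduced words in `Represents` by the action on
    -- `id`.
    represents⇒ : ∀ {t} (x : AffinePermutation k) → t Represents x → id ⟨ t ⟩⇒ to x
    represents⇒ x (w , red , w≗x , t≈w) = Equivalence.from (sound t≈w)
      (⇒-resp (aWord w) (λ _ → refl) w≗x (reduced⇒ [] w red))

    ⇒represents : ∀ As (x : AffinePermutation k) → id ⟨ dProduct As ⟩⇒ to x → dProduct As
      Represents x
    ⇒represents As x p = dWords As , ⇒reduced [] (dWords As) (λ _ _ → z≤n) q ,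
      (λ z → sym (⇒-word (dWords As) q z)) , dProduct≈ As
      where
      q : id ⟨ aWord (dWords As) ⟩⇒ to x
      q = Equivalence.to (sound (dProduct≈ As)) p

    sWord-surjective : ∀ w z → ∃ λ y → sWord {k} w y ≡ z
    sWord-surjective []      z = z , refl
    sWord-surjective (i ∷ w) z =
      let y , eq = sWord-surjective w (s i z) in y , trans (cong (s i) eq) (s-involutive i z)

    -- Right cancellation: `sWord w` is onto, so `h ∘ sWord w` determines `h`.
    ⇒-injective : ∀ w {f h h′} → h ⟨ aWord {k} w ⟩⇒ f → h′ ⟨ aWord w ⟩⇒ f → h ≗ h′
    ⇒-injective w {h = h} {h′} p q z = let y , eq = sWord-surjective w z in
      trans (cong h (sym eq)) (trans (sym (⇒-word w p y)) (trans (⇒-word w q y) (cong h′ eq)))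

    -- The head of the list is the rightmost factor in `dProduct`, so the set peeled off first is
    -- the one compared first in the lexicographic order.
    data Greedy : (ℤ → ℤ) → List (Subset (suc k)) → Set where
      []  : ∀ {f} → f ≗ id → Greedy f []
      _∷_ : ∀ {f h As} → Affine f × Nonempty (coveredSet f) × h ⟨ d (coveredSet f) ⟩⇒ f → Greedy
        h As → Greedy f (coveredSet f ∷ As)

    dWord-nonempty : ∀ {A : Subset (suc k)} → Nonempty A → Proper A → 0 < length (dWord A)
    dWord-nonempty {A} (i , i∈A) A⊂ = positive (Equivalence.from
      (CyclicallyDecreasing.letters (dWord-cyclicallyDecreasing A A⊂) i) i∈A)
      where
      positive : ∀ {w} → i List.∈ w → 0 < length w
      positive (here _)  = s≤s z≤n
      positive (there _) = s≤s z≤n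

    -- The recursion is on a strict bound `n` for the energy. A nonempty set contributes at least
    -- one letter, so each peeled factor lowers the bound.
    greedy : ∀ n {f} → Affine f → total f ≡ 0ℤ → energy f ℤ.< + n → ∃ (Greedy f)
    greedy zero {f} F _ e<0 = contradiction (energy-nonNeg f) (ℤ.<⇒≱ e<0)
    greedy (suc n) {f} F total≡0 e<n with nonempty? (coveredSet f)
    ... | no empty = [] , [] (uncovered⇒id F total≡0 empty)
    ... | yes ne =
        let As , G = greedy n H (trans total≡ total≡0) less in coveredSet f ∷ As , (F , ne , p) ∷ G
      where
      step = covered-factor F
      h = proj₁ step
      p = proj₂ step
      desc = descend (dWord (coveredSet f)) F p
      H = proj₁ desc
      total≡ = proj₁ (proj₂ desc)
      less : energy h ℤ.< + n
      less = +1≤⇒< (<+1⇒≤ (ℤ.≤-<-trans (ℤ.≤-trans (ℤ.+-monoʳ-≤ (energy h)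
        (ℤ.+≤+ (dWord-nonempty ne (covered-proper F)))) (proj₂ (proj₂ desc)))
               (subst (λ m → energy f ℤ.< + m) (ℕ.+-comm 1 n) e<n)))

    greedy-decomposes : ∀ {f As} → Greedy f As → All NonemptyProper As × id ⟨ dProduct As ⟩⇒ f
    greedy-decomposes ([] f≗id) = [] , f≗id
    greedy-decomposes ((F , ne , p) ∷ G) =
      let all , q = greedy-decomposes G in (ne , covered-proper F) ∷ all , _ , q , p

    -- Maximality and uniqueness share one induction: where `Bs` first departs from `As` it either
    -- stops or has a strictly smaller set, which proves the inequality and refutes its converse.
    greedy-best : ∀ {f As} Bs → Greedy f As → All NonemptyProper Bs → id ⟨ dProduct {k} Bs ⟩⇒ f →
                  shape Bs ≤lex shape As × (shape As ≤lex shape Bs → As ≡ Bs)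
    greedy-best [] ([] _) _ _ = base tt , λ _ → refl
    greedy-best [] (_ ∷ _) _ _ = halt , λ ()
    greedy-best {f} (B ∷ Bs) ([] f≗id) (((i , i∈B) , B⊂) ∷ _) (_ , _ , q) =
      -- A nonempty right factor of the identity would make an index covered, but the identity is
      -- increasing.
      contradiction (subst₂ ℤ._<_ (f≗id (z + 1ℤ)) (f≗id (z - + toℕ t)) lt)
        (ℤ.<-asym (ℤ.≤-<-trans (ℤ.i-j≤i z (+ toℕ t)) (i<i+1 z)))
      where
      z = + toℕ i
      F : Affine f
      F = affine-resp (sym ∘ f≗id) id-affine
      covered = ∈covered⁻ F z (subst (_∈ coveredSet f) (sym (residue-toℕ i))
        (factor⊆covered B F B⊂ q i∈B))
      t = proj₁ covered
      lt = proj₂ covered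
    greedy-best (B ∷ Bs) ((F , _ , p) ∷ G) ((_ , B⊂) ∷ all) (h′ , p′ , q) with ⊆⇒≡⊎⊂
      (factor⊆covered B F B⊂ q)
    ... | inj₂ B⊂C = this (ℕ.<⇒≤ lt , ℕ.<⇒≢ lt) ,
            λ { (this (le , _)) → contradiction lt (ℕ.≤⇒≯ le)
              ; (Lex.next eq _)     → contradiction (sym eq) (ℕ.<⇒≢ lt) }
      where lt = p⊂q⇒∣p∣<∣q∣ B⊂C
    -- Equal rightmost factors leave equal maps after cancellation, so the comparison continues with
    -- the tails.
    ... | inj₁ refl = let le , unique = greedy-best Bs G all
                            (⇒-resp (dProduct Bs) (λ _ → refl) (⇒-injective (dWord B) q p) p′)
          in Lex.next refl le ,
            λ { (this (_ , ne)) → contradiction refl ne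
              ; (Lex.next _ lex)    → cong (B ∷_) (unique lex) }

theorem20 : (k : ℕ) → 1 ≤ k → (x : AffinePermutation k) →
    ∃! _≡_ (IsMaximalDecomposition x)
theorem20 k 1≤k x =
  As , (As-dec , λ Bs Bs-dec → proj₁ (best Bs Bs-dec)) ,
  λ {Bs} (Bs-dec , maximal) → proj₂ (best Bs Bs-dec) (maximal As As-dec)
  where
  F = permutation-affine x
  e = energy {k} (to x)
  existence : ∃ (Greedy 1≤k (to x))
  -- The energy is nonnegative, hence equal to its absolute value, and the successor of that is a
  -- strict bound.
  existence = greedy 1≤k (suc ℤ.∣ e ∣) F (permutation-total x)
    (subst (ℤ._< + suc ℤ.∣ e ∣) (ℤ.0≤i⇒+∣i∣≡i (energy-nonNeg {k} (to x))) (ℤ.+<+ ℕ.≤-refl))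
  As = proj₁ existence
  dec = greedy-decomposes 1≤k (proj₂ existence)
  As-dec : IsDecomposition x As
  As-dec = proj₁ dec , ⇒represents 1≤k As x (proj₂ dec)
  best : ∀ Bs → IsDecomposition x Bs →
         shape Bs ≤lex shape As × (shape As ≤lex shape Bs → As ≡ Bs)
  best Bs (all , rep) = greedy-best 1≤k Bs (proj₂ existence) all (represents⇒ 1≤k x rep)
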